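{- \[\lim_{n\to\infty}\frac{\operatorname{Gut}(P_n)}{\operatorname{Kf}^*(P_n)}=3\quad\text{and}\quad\lim_{n\to\infty}\frac{\operatorname{Gut}(P'_n)}{\operatorname{Kf}^*(P'_n)}=3.\]
   Context: For $n\geq 2$, both graphs have vertex set $\{u_1,\dots,u_{2n}\}\cup\{u'_1,\dots,u'_{2n}\}\cup\{w_1,\dots,w_n\}$. Common edges: $u_ku_{k+1}$ and $u'_ku'_{k+1}$ for $1\le k\le 2n-1$; $u_{2k-1}u'_{2k-1}$ for $1\le k\le n$; $u_{2k}w_k$ and $w_ku'_{2k}$ for $1\le k\le n$. The pentagonal cylinder chain $P_n$ additionally has edges $u_{2n}u_1$ and $u'_{2n}u'_1$; the pentagonal Möbius chain $P'_n$ instead has edges $u_{2n}u'_1$ and $u'_{2n}u_1$. For a connected graph with vertices $v_1,\dots,v_N$, degrees $d_i$, distances $d_{ij}$ and effective resistances $r_{ij}$ (unit resistance per edge): $\operatorname{Gut}(G)=\frac12\sum_{i,j}d_id_jd_{ij}$ and $\operatorname{Kf}^*(G)=\frac12\sum_{i,j}d_id_jr_{ij}$ (equivalently $2|E|\sum_{i\ge2}1/\lambda_i$ over the nonzero eigenvalues $\lambda_i$ of the normalized Laplacian). -}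

module Defs where

open import Data.Nat as ℕ using (ℕ; zero; suc; _≡ᵇ_)
open import Data.Fin using (Fin; toℕ)
open import Data.Bool using (Bool; true; false; _∧_; _∨_; if_then_else_)
open import Data.List using (List; []; _∷_; _++_; map; upTo; allFin; foldr)
open import Data.Bool.ListAction using (any)
open import Data.Product using (_×_; _,_; ∃)
open import Data.Integer using (+_)
open import Data.Rational as ℚ using (ℚ; 0ℚ; 1ℚ; ½; _+_; _*_; _-_; _÷_; ≢-nonZero)
open import Data.Rational.Properties using (_≟_)
open import Relation.Nullary using (yes; no)
open import Relation.Binary.PropositionalEquality using (_≡_)

fromℕ : ℕ → ℚ
fromℕ n = + n ℚ./ 1

Σ : {N : ℕ} → (Fin N → ℚ) → ℚ
Σ {N} f = foldr (λ i acc → f i + acc) 0ℚ (allFin N)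

-- total division (only ever used with nonzero denominators)
_÷'_ : ℚ → ℚ → ℚ
p ÷' q with q ≟ 0ℚ
... | yes _ = 0ℚ
... | no q≢0 = _÷_ p q {{≢-nonZero q≢0}}

Adj : ℕ → Set
Adj N = Fin N → Fin N → Bool

deg : {N : ℕ} → Adj N → Fin N → ℕ
deg {N} adj v = foldr (λ u acc → (if adj v u then 1 else 0) ℕ.+ acc) 0 (allFin N)

_=ᶠ_ : {N : ℕ} → Fin N → Fin N → Bool
i =ᶠ j = toℕ i ≡ᵇ toℕ j

reach : {N : ℕ} → Adj N → ℕ → Fin N → Fin N → Bool
reach adj zero i j = i =ᶠ j
reach {N} adj (suc k) i j = reach adj k i j ∨ any (λ m → reach adj k i m ∧ adj m j) (allFin N)

-- least k in [start, start + fuel) satisfying p (default: start + fuel)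
firstFrom : (ℕ → Bool) → ℕ → ℕ → ℕ
firstFrom p k zero = k
firstFrom p k (suc f) = if p k then k else firstFrom p (suc k) f

-- shortest-path distance (for a connected graph on N vertices it is < N)
dist : {N : ℕ} → Adj N → Fin N → Fin N → ℕ
dist {N} adj i j = firstFrom (λ k → reach adj k i j) 0 N

Gut : {N : ℕ} → Adj N → ℚ
Gut adj = ½ * Σ (λ i → Σ (λ j →
  fromℕ (deg adj i ℕ.* deg adj j ℕ.* dist adj i j)))

lap : {N : ℕ} → Adj N → (Fin N → ℚ) → Fin N → ℚ
lap adj x v = fromℕ (deg adj v) * x v - Σ (λ u → if adj v u then x u else 0ℚ)

δ : {N : ℕ} → Fin N → Fin N → ℚ
δ i v = if i =ᶠ v then 1ℚ else 0ℚ

-- R is the effective-resistance function of the (unit-resistance) network: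
-- R i j is the potential difference x_i - x_j when a unit current enters at i
-- and leaves at j, i.e. x solves L x = e_i - e_j.
IsResistance : {N : ℕ} → Adj N → (Fin N → Fin N → ℚ) → Set
IsResistance adj R = ∀ i j → ∃ λ (x : Fin _ → ℚ) →
  (∀ v → lap adj x v ≡ δ i v - δ j v) × (R i j ≡ x i - x j)

KfStar : {N : ℕ} → Adj N → (Fin N → Fin N → ℚ) → ℚ
KfStar adj R = ½ * Σ (λ i → Σ (λ j →
  fromℕ (deg adj i ℕ.* deg adj j) * R i j))

fromEdges : {N : ℕ} → List (ℕ × ℕ) → Adj N
fromEdges es i j = any (λ e → match e) es
  where
  match : ℕ × ℕ → Bool
  match (a , b) = ((a ≡ᵇ toℕ i) ∧ (b ≡ᵇ toℕ j)) ∨ ((a ≡ᵇ toℕ j) ∧ (b ≡ᵇ toℕ i))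

-- Pentagonal chains. Labels (0-based, total 5n vertices):
--   u_k  ↦ k - 1          (1 ≤ k ≤ 2n)
--   u'_k ↦ 2n + k - 1     (1 ≤ k ≤ 2n)
--   w_k  ↦ 4n + k - 1     (1 ≤ k ≤ n)

commonEdges : ℕ → List (ℕ × ℕ)
commonEdges n =
     map (λ i → (i , suc i)) (upTo (2 ℕ.* n ℕ.∸ 1))                          -- u_k u_{k+1}
  ++ map (λ i → (2 ℕ.* n ℕ.+ i , 2 ℕ.* n ℕ.+ suc i)) (upTo (2 ℕ.* n ℕ.∸ 1))  -- u'_k u'_{k+1}
  ++ map (λ i → (2 ℕ.* i , 2 ℕ.* n ℕ.+ 2 ℕ.* i)) (upTo n)                    -- u_{2k-1} u'_{2k-1}
  ++ map (λ i → (suc (2 ℕ.* i) , 4 ℕ.* n ℕ.+ i)) (upTo n)                    -- u_{2k} w_k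
  ++ map (λ i → (4 ℕ.* n ℕ.+ i , 2 ℕ.* n ℕ.+ suc (2 ℕ.* i))) (upTo n)        -- w_k u'_{2k}

-- pentagonal cylinder chain P_n : extra edges u_{2n} u_1, u'_{2n} u'_1
cylinderEdges : ℕ → List (ℕ × ℕ)
cylinderEdges n = (2 ℕ.* n ℕ.∸ 1 , 0) ∷ (4 ℕ.* n ℕ.∸ 1 , 2 ℕ.* n) ∷ commonEdges n

-- pentagonal Möbius chain P'_n : extra edges u_{2n} u'_1, u'_{2n} u_1
moebiusEdges : ℕ → List (ℕ × ℕ)
moebiusEdges n = (2 ℕ.* n ℕ.∸ 1 , 2 ℕ.* n) ∷ (4 ℕ.* n ℕ.∸ 1 , 0) ∷ commonEdges n

Pcyl : (n : ℕ) → Adj (5 ℕ.* n)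
Pcyl n = fromEdges (cylinderEdges n)

Pmob : (n : ℕ) → Adj (5 ℕ.* n)
Pmob n = fromEdges (moebiusEdges n)

RatioTendsTo3 : ((n : ℕ) → Adj (5 ℕ.* n)) → Set
RatioTendsTo3 G = ∀ (ε : ℚ) → ε ℚ.> 0ℚ → ∃ λ (n₀ : ℕ) → ∀ (n : ℕ) → 2 ℕ.≤ n → n₀ ℕ.≤ n →
  ∀ (R : Fin (5 ℕ.* n) → Fin (5 ℕ.* n) → ℚ) → IsResistance (G n) R →
  ℚ.∣ (Gut (G n) ÷' KfStar (G n) R) - fromℕ 3 ∣ ℚ.< ε

{-# OPTIONS --safe #-}
-- Place the vertices u_k, u′_k at position k of a cycle of length m = 2n, and w_k at position 2k.  For two vertices i, j
-- at positions p, q put e = |p - q| and c = min (e, m - e); their graph distance d lies between c and c + 4.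
-- A potential x of the unit current from i to j satisfies Σ_{ab ∈ E} (Y_a - Y_b) (x_a - x_b) = Y_i - Y_j for all functions
-- Y on the vertices.  With Y = min (position, t) for t = p, q, m - 1, this yields m (Z_p - Z_q) = e (m - e) for the sums
-- Z_k = x(u_k) + x(u′_k); with Y an indicator, it bounds the potential drop along an edge by 1.  Hence the resistance r
-- satisfies 2 m r = e (m - e) + O(m), and 2 m (d - 3 r) differs from H(e) = 2 m c - 3 e (m - e) by O(m).
-- The sum of H over a period is only n, because Σ c = m²/4 and Σ e (m - e) = (m³ - m)/6; the vertices at a position
-- have total degree 6 or 8 alternately, which perturbs 7 times this sum by O(m²) since H is O(m)-Lipschitz.
-- So Gut - 3 Kf* = O(n²), whereas Kf* grows like n³.

module Submission where

open import Defs
open import Data.Bool using (Bool; T; true; false; if_then_else_; _∧_; _∨_)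
open import Data.Bool.ListAction using (any)
open import Data.Empty using (⊥; ⊥-elim)
open import Data.Fin as Fin using (Fin; toℕ; fromℕ<)
import Data.Fin.Properties as Fin
import Data.Integer as ℤ
import Data.Integer.Properties as ℤ
open import Data.List using (List; []; _∷_; _++_; map; foldr; upTo; applyUpTo; tabulate; allFin)
import Data.List.Properties as List
open import Data.List.Membership.Propositional using (_∈_)
open import Data.List.Membership.Propositional.Properties using (∈-++⁺ˡ; ∈-++⁺ʳ; ∈-map⁺; ∈-upTo⁺; ∈-allFin)
open import Data.List.Relation.Unary.All as All using (All; []; _∷_)
import Data.List.Relation.Unary.All.Properties as All
open import Data.List.Relation.Unary.AllPairs using (AllPairs; []; _∷_)
import Data.List.Relation.Unary.AllPairs.Properties as AllPairs
open import Data.List.Relation.Unary.Any using (here; there)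
open import Data.Nat as ℕ using (ℕ; zero; suc; z≤n; s≤s; _≡ᵇ_)
import Data.Nat.Properties as ℕ
open import Data.Product using (_×_; _,_; proj₁; proj₂; ∃)
open import Data.Rational as ℚ using (ℚ; 0ℚ; 1ℚ; ½; _+_; _*_; _-_; -_; _≤_; _<_; ∣_∣; toℚᵘ; nonNegative)
open import Data.Rational.Properties as ℚ using (≤-refl; ≤-trans; ≤-reflexive)
import Data.Rational.Unnormalised as ℚᵘ
import Data.Rational.Unnormalised.Properties as ℚᵘ
open import Data.Sum using (_⊎_; inj₁; inj₂)
open import Function using (_∘_; id)
open import Level using (0ℓ)
open import Relation.Binary.PropositionalEquality
  using (_≡_; _≢_; _≗_; refl; sym; trans; cong; cong₂; subst; subst₂; module ≡-Reasoning)
open import Relation.Nullary using (yes; no)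
open import Relation.Nullary.Decidable using (dec⇒maybe)
open import Tactic.RingSolver using (solve-∀)
open import Tactic.RingSolver.Core.AlmostCommutativeRing using (AlmostCommutativeRing; fromCommutativeRing)


-- The two rails act as parallel wires: resistances are about half those of a plain cycle and
-- average m/12, against a mean distance of m/4. Since only cubic leading terms matter, an error of
-- constant size is accepted for every pair of vertices. The sums Z_k are what a test function of
-- the position alone can see. Rungs join vertices at one position and drop out, and the Möbius
-- twist merely exchanges the two values at position 0, whose sum stays the same; so both chains
-- share one argument. Three thresholds are used because there are three unknowns: Z_p - Z_0, Z_q -
-- Z_0 and the drop Z_(m-1) - Z_0 across the wrap. Single potentials are recovered from Z by the
-- bound on edge drops, as vertices at one position are at most two edges apart. The growth of Kf*
-- is not estimated directly: it follows from a lower bound on Gut together with the bound on Gut -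
-- 3 Kf*.

ℚ-ring : AlmostCommutativeRing 0ℓ 0ℓ
ℚ-ring = fromCommutativeRing ℚ.+-*-commutativeRing (λ x → dec⇒maybe (0ℚ ℚ.≟ x))

-- Casts and inequalities

fromℕ≃ : ∀ n → toℚᵘ (fromℕ n) ℚᵘ.≃ ℚᵘ.mkℚᵘ (ℤ.+ n) 0
fromℕ≃ n = ℚ.toℚᵘ-fromℚᵘ (ℚᵘ.mkℚᵘ (ℤ.+ n) 0)

fromℕ-+ : ∀ a b → fromℕ (a ℕ.+ b) ≡ fromℕ a + fromℕ b
fromℕ-+ a b = ℚ.toℚᵘ-injective (begin
  toℚᵘ (fromℕ (a ℕ.+ b))                        ≈⟨ fromℕ≃ (a ℕ.+ b) ⟩
  ℚᵘ.mkℚᵘ (ℤ.+ (a ℕ.+ b)) 0                       ≈⟨ ℚᵘ.*≡* (cong (ℤ._* ℤ.+ 1) (cong₂ ℤ._+_ (sym (ℤ.*-identityʳ (ℤ.+ a))) (sym (ℤ.*-identityʳ (ℤ.+ b))))) ⟩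
  ℚᵘ.mkℚᵘ (ℤ.+ a) 0 ℚᵘ.+ ℚᵘ.mkℚᵘ (ℤ.+ b) 0          ≈⟨ ℚᵘ.+-cong (fromℕ≃ a) (fromℕ≃ b) ⟨
  toℚᵘ (fromℕ a) ℚᵘ.+ toℚᵘ (fromℕ b)            ≈⟨ ℚ.toℚᵘ-homo-+ (fromℕ a) (fromℕ b) ⟨
  toℚᵘ (fromℕ a + fromℕ b)                      ∎)
  where open ℚᵘ.≃-Reasoning

fromℕ-* : ∀ a b → fromℕ (a ℕ.* b) ≡ fromℕ a * fromℕ b
fromℕ-* a b = ℚ.toℚᵘ-injective (begin
  toℚᵘ (fromℕ (a ℕ.* b))                        ≈⟨ fromℕ≃ (a ℕ.* b) ⟩
  ℚᵘ.mkℚᵘ (ℤ.+ (a ℕ.* b)) 0                       ≈⟨ ℚᵘ.*≡* (cong (ℤ._* ℤ.+ 1) (ℤ.pos-* a b)) ⟩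
  ℚᵘ.mkℚᵘ (ℤ.+ a) 0 ℚᵘ.* ℚᵘ.mkℚᵘ (ℤ.+ b) 0          ≈⟨ ℚᵘ.*-cong (fromℕ≃ a) (fromℕ≃ b) ⟨
  toℚᵘ (fromℕ a) ℚᵘ.* toℚᵘ (fromℕ b)            ≈⟨ ℚ.toℚᵘ-homo-* (fromℕ a) (fromℕ b) ⟨
  toℚᵘ (fromℕ a * fromℕ b)                      ∎)
  where open ℚᵘ.≃-Reasoning

fromℕ-suc : ∀ a → fromℕ (suc a) ≡ 1ℚ + fromℕ a
fromℕ-suc = fromℕ-+ 1

fromℕ-mono : ∀ {a b} → a ℕ.≤ b → fromℕ a ≤ fromℕ b
fromℕ-mono {a} {b} a≤b = ℚ.toℚᵘ-cancel-≤ (begin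
  toℚᵘ (fromℕ a)    ≃⟨ fromℕ≃ a ⟩
  ℚᵘ.mkℚᵘ (ℤ.+ a) 0   ≤⟨ ℚᵘ.*≤* (ℤ.*-monoʳ-≤-nonNeg (ℤ.+ 1) (ℤ.+≤+ a≤b)) ⟩
  ℚᵘ.mkℚᵘ (ℤ.+ b) 0   ≃⟨ fromℕ≃ b ⟨
  toℚᵘ (fromℕ b)    ∎)
  where open ℚᵘ.≤-Reasoning

fromℕ-nonneg : ∀ a → 0ℚ ≤ fromℕ a
fromℕ-nonneg a = fromℕ-mono {0} {a} z≤n

-- Reduces linear arithmetic to ring identities.
≤-shift : ∀ {a b c d} → a ≤ b → d - c ≡ b - a → c ≤ d
≤-shift {a} {b} {c} {d} a≤b eq = subst₂ _≤_ (lem a c)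
  (trans (lem′ b a c) (trans (cong (c +_) (sym eq)) (lem″ c d))) (ℚ.+-monoˡ-≤ (c - a) a≤b)
  where
  lem : ∀ a c → a + (c - a) ≡ c
  lem = solve-∀ ℚ-ring
  lem′ : ∀ b a c → b + (c - a) ≡ c + (b - a)
  lem′ = solve-∀ ℚ-ring
  lem″ : ∀ c d → c + (d - c) ≡ d
  lem″ = solve-∀ ℚ-ring

*-mono-nonneg : ∀ {r a b} → 0ℚ ≤ r → a ≤ b → r * a ≤ r * b
*-mono-nonneg {r} 0≤r = ℚ.*-monoˡ-≤-nonNeg r {{nonNegative 0≤r}}

*-nonneg : ∀ {a b} → 0ℚ ≤ a → 0ℚ ≤ b → 0ℚ ≤ a * b
*-nonneg {a} 0≤a 0≤b = ≤-trans (≤-reflexive (sym (ℚ.*-zeroʳ a))) (*-mono-nonneg 0≤a 0≤b)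

+-nonneg : ∀ {a b} → 0ℚ ≤ a → 0ℚ ≤ b → 0ℚ ≤ a + b
+-nonneg = ℚ.+-mono-≤

∣∣-intro : ∀ {x b} → x ≤ b → - x ≤ b → ∣ x ∣ ≤ b
∣∣-intro {x} x≤b -x≤b with ℚ.∣p∣≡p∨∣p∣≡-p x
... | inj₁ eq = ≤-trans (≤-reflexive eq) x≤b
... | inj₂ eq = ≤-trans (≤-reflexive eq) -x≤b

x≤∣x∣ : ∀ x → x ≤ ∣ x ∣
x≤∣x∣ x with ℚ.≤-total 0ℚ x
... | inj₁ 0≤x = ≤-reflexive (sym (ℚ.0≤p⇒∣p∣≡p 0≤x))
... | inj₂ x≤0 = ≤-trans x≤0 (ℚ.nonNegative⁻¹ ∣ x ∣ {{ℚ.∣-∣-nonNeg x}})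

-x≤∣x∣ : ∀ x → - x ≤ ∣ x ∣
-x≤∣x∣ x = ≤-trans (x≤∣x∣ (- x)) (≤-reflexive (ℚ.∣-p∣≡∣p∣ x))

∣∣-+ : ∀ x y {a b} → ∣ x ∣ ≤ a → ∣ y ∣ ≤ b → ∣ x + y ∣ ≤ a + b
∣∣-+ x y x≤a y≤b = ≤-trans (ℚ.∣p+q∣≤∣p∣+∣q∣ x y) (ℚ.+-mono-≤ x≤a y≤b)

∣∣-* : ∀ {r x a} → 0ℚ ≤ r → ∣ x ∣ ≤ a → ∣ r * x ∣ ≤ r * a
∣∣-* {r} {x} 0≤r x≤a = ≤-trans
  (≤-reflexive (trans (ℚ.∣p*q∣≡∣p∣*∣q∣ r x) (cong (_* ∣ x ∣) (ℚ.0≤p⇒∣p∣≡p 0≤r))))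
  (*-mono-nonneg 0≤r x≤a)

-- Finite sums

∑ : ∀ {A : Set} → List A → (A → ℚ) → ℚ
∑ []       f = 0ℚ
∑ (x ∷ xs) f = f x + ∑ xs f

module _ {A : Set} where

  ∑-cong : ∀ (xs : List A) {f g} → f ≗ g → ∑ xs f ≡ ∑ xs g
  ∑-cong []       f≗g = refl
  ∑-cong (x ∷ xs) f≗g = cong₂ _+_ (f≗g x) (∑-cong xs f≗g)

  ∑-zero : ∀ (xs : List A) → ∑ xs (λ _ → 0ℚ) ≡ 0ℚ
  ∑-zero []       = refl
  ∑-zero (x ∷ xs) = trans (ℚ.+-identityˡ _) (∑-zero xs)

  ∑-+ : ∀ (xs : List A) f g → ∑ xs (λ x → f x + g x) ≡ ∑ xs f + ∑ xs g
  ∑-+ []       f g = refl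
  ∑-+ (x ∷ xs) f g = trans (cong ((f x + g x) +_) (∑-+ xs f g)) (lem (f x) (g x) (∑ xs f) (∑ xs g))
    where
    lem : ∀ a b c d → (a + b) + (c + d) ≡ (a + c) + (b + d)
    lem = solve-∀ ℚ-ring

  ∑-*ˡ : ∀ (xs : List A) c f → ∑ xs (λ x → c * f x) ≡ c * ∑ xs f
  ∑-*ˡ []       c f = sym (ℚ.*-zeroʳ c)
  ∑-*ˡ (x ∷ xs) c f = trans (cong (c * f x +_) (∑-*ˡ xs c f)) (sym (ℚ.*-distribˡ-+ c (f x) (∑ xs f)))

  ∑-*ʳ : ∀ (xs : List A) c f → ∑ xs (λ x → f x * c) ≡ ∑ xs f * c
  ∑-*ʳ xs c f = trans (∑-cong xs (λ x → ℚ.*-comm (f x) c)) (trans (∑-*ˡ xs c f) (ℚ.*-comm c _))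

  ∑-- : ∀ (xs : List A) f g → ∑ xs (λ x → f x - g x) ≡ ∑ xs f - ∑ xs g
  ∑-- []       f g = refl
  ∑-- (x ∷ xs) f g = trans (cong ((f x - g x) +_) (∑-- xs f g)) (lem (f x) (g x) (∑ xs f) (∑ xs g))
    where
    lem : ∀ a b c d → (a - b) + (c - d) ≡ (a + c) - (b + d)
    lem = solve-∀ ℚ-ring

  ∑-mono : ∀ (xs : List A) {f g} → (∀ x → f x ≤ g x) → ∑ xs f ≤ ∑ xs g
  ∑-mono []       f≤g = ≤-refl
  ∑-mono (x ∷ xs) f≤g = ℚ.+-mono-≤ (f≤g x) (∑-mono xs f≤g)

  ∑-∣∣ : ∀ (xs : List A) {f g} → (∀ x → ∣ f x ∣ ≤ g x) → ∣ ∑ xs f ∣ ≤ ∑ xs g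
  ∑-∣∣ []       f≤g = ≤-refl
  ∑-∣∣ (x ∷ xs) {f} f≤g = ∣∣-+ (f x) (∑ xs f) (f≤g x) (∑-∣∣ xs f≤g)

  ∑-++ : ∀ (xs ys : List A) f → ∑ (xs ++ ys) f ≡ ∑ xs f + ∑ ys f
  ∑-++ []       ys f = sym (ℚ.+-identityˡ _)
  ∑-++ (x ∷ xs) ys f = trans (cong (f x +_) (∑-++ xs ys f)) (sym (ℚ.+-assoc (f x) _ _))

  ∑-map : ∀ {B : Set} (g : B → A) xs f → ∑ (map g xs) f ≡ ∑ xs (f ∘ g)
  ∑-map g []       f = refl
  ∑-map g (x ∷ xs) f = cong (f (g x) +_) (∑-map g xs f)

  ∑-foldr : ∀ (xs : List A) f → foldr (λ x acc → f x + acc) 0ℚ xs ≡ ∑ xs f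
  ∑-foldr []       f = refl
  ∑-foldr (x ∷ xs) f = cong (f x +_) (∑-foldr xs f)

  ∑-member : ∀ (xs : List A) f → (∀ x → 0ℚ ≤ f x) → ∀ {x} → x ∈ xs → f x ≤ ∑ xs f
  ∑-member (x ∷ xs) f 0≤f (here refl) = ≤-trans (≤-reflexive (sym (ℚ.+-identityʳ (f x))))
    (ℚ.+-monoʳ-≤ (f x) (≤-trans (≤-reflexive (sym (∑-zero xs))) (∑-mono xs 0≤f)))
  ∑-member (x ∷ xs) f 0≤f (there x∈xs) = ≤-trans (∑-member xs f 0≤f x∈xs)
    (≤-trans (≤-reflexive (sym (ℚ.+-identityˡ _))) (ℚ.+-monoˡ-≤ (∑ xs f) (0≤f x)))

∑-swap : ∀ {A B : Set} (xs : List A) (ys : List B) (f : A → B → ℚ) →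
  ∑ xs (λ x → ∑ ys (f x)) ≡ ∑ ys (λ y → ∑ xs (λ x → f x y))
∑-swap []       ys f = sym (∑-zero ys)
∑-swap (x ∷ xs) ys f = trans (cong (∑ ys (f x) +_) (∑-swap xs ys f)) (sym (∑-+ ys (f x) (λ y → ∑ xs (λ x → f x y))))

∑< : ℕ → (ℕ → ℚ) → ℚ
∑< n = ∑ (upTo n)

∑<-suc : ∀ n f → ∑< (suc n) f ≡ f 0 + ∑< n (f ∘ suc)
∑<-suc n f = cong (f 0 +_) (trans (cong (λ xs → ∑ xs f) (sym (List.map-upTo suc n))) (∑-map suc (upTo n) f))

∑<-last : ∀ n f → ∑< (suc n) f ≡ ∑< n f + f n
∑<-last n f = trans (cong (λ xs → ∑ xs f) (sym (List.upTo-∷ʳ n)))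
  (trans (∑-++ (upTo n) (n ∷ []) f) (cong (∑< n f +_) (ℚ.+-identityʳ (f n))))

∑<-cong : ∀ n {f g} → (∀ i → i ℕ.< n → f i ≡ g i) → ∑< n f ≡ ∑< n g
∑<-cong zero    f≗g = refl
∑<-cong (suc n) {f} {g} f≗g = trans (∑<-last n f) (trans
  (cong₂ _+_ (∑<-cong n (λ i i<n → f≗g i (ℕ.m<n⇒m<1+n i<n))) (f≗g n ℕ.≤-refl)) (sym (∑<-last n g)))

∑<-∣∣ : ∀ n {f g} → (∀ i → i ℕ.< n → ∣ f i ∣ ≤ g i) → ∣ ∑< n f ∣ ≤ ∑< n g
∑<-∣∣ zero    f≤g = ≤-refl
∑<-∣∣ (suc n) {f} {g} f≤g = subst₂ _≤_ (cong ∣_∣ (sym (∑<-last n f))) (sym (∑<-last n g))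
  (∣∣-+ (∑< n f) (f n) (∑<-∣∣ n (λ i i<n → f≤g i (ℕ.m<n⇒m<1+n i<n))) (f≤g n ℕ.≤-refl))

∑<-const : ∀ n c → ∑< n (λ _ → c) ≡ fromℕ n * c
∑<-const zero    c = sym (ℚ.*-zeroˡ c)
∑<-const (suc n) c = trans (∑<-suc n (λ _ → c)) (trans (cong (c +_) (∑<-const n c))
  (trans (lem c (fromℕ n)) (cong (_* c) (sym (fromℕ-suc n)))))
  where
  lem : ∀ c n → c + n * c ≡ (1ℚ + n) * c
  lem = solve-∀ ℚ-ring

∑<-+ : ∀ a b f → ∑< (a ℕ.+ b) f ≡ ∑< a f + ∑< b (λ i → f (a ℕ.+ i))
∑<-+ zero    b f = sym (ℚ.+-identityˡ _)
∑<-+ (suc a) b f = trans (∑<-suc (a ℕ.+ b) f) (trans (cong (f 0 +_) (∑<-+ a b (f ∘ suc)))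
  (trans (sym (ℚ.+-assoc (f 0) _ _)) (cong (_+ ∑< b (λ i → f (suc a ℕ.+ i))) (sym (∑<-suc a f)))))

∑-allFin : ∀ N (f : ℕ → ℚ) → ∑ (allFin N) (f ∘ toℕ) ≡ ∑< N f
∑-allFin N f = trans (sym (∑-map toℕ (allFin N) f)) (cong (λ xs → ∑ xs f) (trans (List.map-tabulate id toℕ) (tabulate-toℕ N id)))
  where
  tabulate-toℕ : ∀ N (g : ℕ → ℕ) → tabulate {n = N} (g ∘ toℕ) ≡ applyUpTo g N
  tabulate-toℕ zero    g = refl
  tabulate-toℕ (suc N) g = cong (g 0 ∷_) (tabulate-toℕ N (g ∘ suc))

⟦_⟧ : Bool → ℚ
⟦ b ⟧ = if b then 1ℚ else 0ℚ

∑<-pick : ∀ N a (f : ℕ → ℚ) → a ℕ.< N → ∑< N (λ v → ⟦ a ≡ᵇ v ⟧ * f v) ≡ f a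
∑<-pick (suc N) zero    f _         = trans (∑<-suc N (λ v → ⟦ 0 ≡ᵇ v ⟧ * f v))
  (trans (cong₂ _+_ (ℚ.*-identityˡ (f 0)) (trans (∑-cong (upTo N) (λ v → ℚ.*-zeroˡ (f (suc v)))) (∑-zero (upTo N))))
    (ℚ.+-identityʳ (f 0)))
∑<-pick (suc N) (suc a) f (s≤s a<N) = trans (∑<-suc N (λ v → ⟦ suc a ≡ᵇ v ⟧ * f v))
  (trans (cong₂ _+_ (ℚ.*-zeroˡ (f 0)) (∑<-pick N a (f ∘ suc) a<N)) (ℚ.+-identityˡ _))

-- The first factor is -1 for p below `c` and 0 from `c` on, so the sum telescopes and stops at the
-- smaller of `l` and `c`.
∑<-clamp : ∀ l c (Z : ℕ → ℚ) →
  ∑< l (λ p → (fromℕ (p ℕ.⊓ c) - fromℕ (suc p ℕ.⊓ c)) * (Z p - Z (suc p))) ≡ Z (l ℕ.⊓ c) - Z 0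
∑<-clamp zero    c Z = sym (ℚ.+-inverseʳ (Z 0))
∑<-clamp (suc l) c Z = trans (∑<-last l _) (trans (cong (_+ (fromℕ (l ℕ.⊓ c) - fromℕ (suc l ℕ.⊓ c)) * (Z l - Z (suc l))) (∑<-clamp l c Z)) last)
  where
  last : (Z (l ℕ.⊓ c) - Z 0) + (fromℕ (l ℕ.⊓ c) - fromℕ (suc l ℕ.⊓ c)) * (Z l - Z (suc l)) ≡ Z (suc l ℕ.⊓ c) - Z 0
  last with ℕ.<-≤-connex l c
  ... | inj₁ l<c rewrite ℕ.m≤n⇒m⊓n≡m (ℕ.<⇒≤ l<c) | ℕ.m≤n⇒m⊓n≡m l<c | fromℕ-suc l = lem (Z l) (Z 0) (Z (suc l)) (fromℕ l)
    where
    lem : ∀ a b c d → (a - b) + (d - (1ℚ + d)) * (a - c) ≡ c - b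
    lem = solve-∀ ℚ-ring
  ... | inj₂ c≤l rewrite ℕ.m≥n⇒m⊓n≡n c≤l | ℕ.m≥n⇒m⊓n≡n (ℕ.m≤n⇒m≤1+n c≤l) = lem (Z c) (Z 0) (fromℕ c) (Z l - Z (suc l))
    where
    lem : ∀ a b c d → (a - b) + (c - c) * d ≡ a - b
    lem = solve-∀ ℚ-ring

-- Links the gap of two positions to the minimum that clamped test functions produce, uniformly in
-- the order of `a` and `b`.
fromℕ-∣-∣ : ∀ a b → fromℕ a + fromℕ b ≡ fromℕ ℕ.∣ a - b ∣ + (fromℕ (a ℕ.⊓ b) + fromℕ (a ℕ.⊓ b))
fromℕ-∣-∣ a b = trans (sym (fromℕ-+ a b)) (trans (cong fromℕ (lem a b)) (trans (fromℕ-+ ℕ.∣ a - b ∣ _) (cong (fromℕ ℕ.∣ a - b ∣ +_) (fromℕ-+ (a ℕ.⊓ b) (a ℕ.⊓ b)))))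
  where
  lem′ : ∀ {a b} → a ℕ.≤ b → a ℕ.+ b ≡ ℕ.∣ a - b ∣ ℕ.+ (a ℕ.+ a)
  lem′ {a} {b} a≤b = trans (cong (a ℕ.+_) (sym (ℕ.m+[n∸m]≡n a≤b))) (trans (sym (ℕ.+-assoc a a _))
    (trans (ℕ.+-comm (a ℕ.+ a) (b ℕ.∸ a)) (cong (ℕ._+ (a ℕ.+ a)) (sym (ℕ.m≤n⇒∣m-n∣≡n∸m a≤b)))))
  lem : ∀ a b → a ℕ.+ b ≡ ℕ.∣ a - b ∣ ℕ.+ (a ℕ.⊓ b ℕ.+ a ℕ.⊓ b)
  lem a b with ℕ.≤-total a b
  ... | inj₁ a≤b rewrite ℕ.m≤n⇒m⊓n≡m a≤b = lem′ a≤b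
  ... | inj₂ b≤a rewrite ℕ.m≥n⇒m⊓n≡n b≤a = trans (ℕ.+-comm a b) (trans (lem′ b≤a) (cong (ℕ._+ (b ℕ.+ b)) (ℕ.∣-∣-comm b a)))

square : ∀ a b e → a + b ≡ e + (a + a) → e * e ≡ (a - b) * (a - b)
square a b e eq = trans (cong (λ e → e * e) (trans (lem₁ e (a + a)) (cong (_- (a + a)) (sym eq)))) (lem₂ a b)
  where
  lem₁ : ∀ e c → e ≡ (e + c) - c
  lem₁ = solve-∀ ℚ-ring
  lem₂ : ∀ a b → ((a + b) - (a + a)) * ((a + b) - (a + a)) ≡ (a - b) * (a - b)
  lem₂ = solve-∀ ℚ-ring

fromℕ-∣-∣² : ∀ a b → fromℕ ℕ.∣ a - b ∣ * fromℕ ℕ.∣ a - b ∣ ≡ (fromℕ a - fromℕ b) * (fromℕ a - fromℕ b)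
fromℕ-∣-∣² a b with ℕ.≤-total a b | fromℕ-∣-∣ a b
... | inj₁ a≤b | eq rewrite ℕ.m≤n⇒m⊓n≡m a≤b = square (fromℕ a) (fromℕ b) (fromℕ ℕ.∣ a - b ∣) eq
... | inj₂ b≤a | eq rewrite ℕ.m≥n⇒m⊓n≡n b≤a = trans
  (square (fromℕ b) (fromℕ a) (fromℕ ℕ.∣ a - b ∣) (trans (ℚ.+-comm (fromℕ b) (fromℕ a)) eq)) (lem (fromℕ a) (fromℕ b))
  where
  lem : ∀ a b → (b - a) * (b - a) ≡ (a - b) * (a - b)
  lem = solve-∀ ℚ-ring

∑<-double : ∀ n (h : ℕ → ℚ) → ∑< (2 ℕ.* n) h ≡ ∑< n (λ k → h (2 ℕ.* k)) + ∑< n (λ k → h (suc (2 ℕ.* k)))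
∑<-double zero    h = refl
∑<-double (suc n) h = trans (cong (λ m → ∑< m h) (ℕ.*-suc 2 n)) (trans (∑<-last (suc (2 ℕ.* n)) h)
  (trans (cong (_+ h (suc (2 ℕ.* n))) (trans (∑<-last (2 ℕ.* n) h) (cong (_+ h (2 ℕ.* n)) (∑<-double n h))))
  (trans (lem (∑< n (λ k → h (2 ℕ.* k))) (∑< n (λ k → h (suc (2 ℕ.* k)))) (h (2 ℕ.* n)) (h (suc (2 ℕ.* n))))
    (cong₂ _+_ (sym (∑<-last n (λ k → h (2 ℕ.* k)))) (sym (∑<-last n (λ k → h (suc (2 ℕ.* k)))))))))
  where
  lem : ∀ a b c d → ((a + b) + c) + d ≡ (a + c) + (b + d)
  lem = solve-∀ ℚ-ring

-- Simple graphs given by edge lists on the vertices 0, …, N - 1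

joins : ℕ × ℕ → ℕ → ℕ → Bool
joins (a , b) i j = ((a ≡ᵇ i) ∧ (b ≡ᵇ j)) ∨ ((a ≡ᵇ j) ∧ (b ≡ᵇ i))

-- `fromEdges es v u` unfolds to `adj es (toℕ v) (toℕ u)`; with labels in ℕ, vertices can be shifted
-- and summed over arithmetically.
adj : List (ℕ × ℕ) → ℕ → ℕ → Bool
adj es i j = any (λ e → joins e i j) es

IsEdge : ℕ → ℕ × ℕ → Set
IsEdge N (a , b) = a ℕ.< N × b ℕ.< N × a ≢ b

-- Excluding a common pair of ends is what turns the disjunction `any` into a sum in `⟦any⟧`.
record Distinct (e e′ : ℕ × ℕ) : Set where
  field ¬both : ∀ i j → joins e i j ≡ true → joins e′ i j ≡ true → ⊥
open Distinct

≡ᵇ-true : ∀ a b → (a ≡ᵇ b) ≡ true → a ≡ b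
≡ᵇ-true a b eq = ℕ.≡ᵇ⇒≡ a b (subst T (sym eq) _)

≡ᵇ-refl : ∀ a → (a ≡ᵇ a) ≡ true
≡ᵇ-refl zero    = refl
≡ᵇ-refl (suc a) = ≡ᵇ-refl a

joins-elim : ∀ a b i j → joins (a , b) i j ≡ true → (a ≡ i × b ≡ j) ⊎ (a ≡ j × b ≡ i)
joins-elim a b i j eq with a ≡ᵇ i in ai | b ≡ᵇ j in bj | a ≡ᵇ j in aj | b ≡ᵇ i in bi
... | true  | true  | _    | _    = inj₁ (≡ᵇ-true a i ai , ≡ᵇ-true b j bj)
... | true  | false | true | true = inj₂ (≡ᵇ-true a j aj , ≡ᵇ-true b i bi)
... | false | _     | true | true = inj₂ (≡ᵇ-true a j aj , ≡ᵇ-true b i bi)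

-- A loop would match in both orientations at once and be counted twice on the right; `a ≢ b`
-- excludes this.
⟦joins⟧ : ∀ a b i j → a ≢ b →
  ⟦ joins (a , b) i j ⟧ ≡ ⟦ a ≡ᵇ i ⟧ * ⟦ b ≡ᵇ j ⟧ + ⟦ b ≡ᵇ i ⟧ * ⟦ a ≡ᵇ j ⟧
⟦joins⟧ a b i j a≢b with a ≡ᵇ i in ai | b ≡ᵇ j in bj | a ≡ᵇ j in aj | b ≡ᵇ i in bi
... | true  | _     | _     | true  = ⊥-elim (a≢b (trans (≡ᵇ-true a i ai) (sym (≡ᵇ-true b i bi))))
... | _     | true  | true  | _     = ⊥-elim (a≢b (trans (≡ᵇ-true a j aj) (sym (≡ᵇ-true b j bj))))
... | true  | true  | false | false = refl
... | true  | false | true  | false = refl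
... | true  | false | false | false = refl
... | false | true  | false | true  = refl
... | false | true  | false | false = refl
... | false | false | true  | true  = refl
... | false | false | true  | false = refl
... | false | false | false | true  = refl
... | false | false | false | false = refl

⟦any⟧ : ∀ e es i j → All (Distinct e) es → ⟦ adj (e ∷ es) i j ⟧ ≡ ⟦ joins e i j ⟧ + ⟦ adj es i j ⟧
⟦any⟧ e es i j e# with joins e i j in eq
... | false = sym (ℚ.+-identityˡ _)
... | true  = cong (λ b → 1ℚ + ⟦ b ⟧) (sym (none es e#))
  where
  none : ∀ es → All (Distinct e) es → adj es i j ≡ false
  none []        []           = refl
  none (e′ ∷ es) (e#e′ ∷ e#) with joins e′ i j in eq′
  ... | true  = ⊥-elim (¬both e#e′ i j eq eq′)
  ... | false = none es e#

∑∑ : ℕ → (ℕ → ℕ → ℚ) → ℚ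
∑∑ N F = ∑< N (λ v → ∑< N (F v))

∑∑-cong : ∀ N {F G} → (∀ v u → F v u ≡ G v u) → ∑∑ N F ≡ ∑∑ N G
∑∑-cong N eq = ∑-cong (upTo N) (λ v → ∑-cong (upTo N) (eq v))

∑∑-+ : ∀ N F G → ∑∑ N (λ v u → F v u + G v u) ≡ ∑∑ N F + ∑∑ N G
∑∑-+ N F G = trans (∑-cong (upTo N) (λ v → ∑-+ (upTo N) (F v) (G v)))
  (∑-+ (upTo N) (λ v → ∑< N (F v)) (λ v → ∑< N (G v)))

∑∑-pick : ∀ N a b (F : ℕ → ℕ → ℚ) → a ℕ.< N → b ℕ.< N → ∑∑ N (λ v u → ⟦ a ≡ᵇ v ⟧ * ⟦ b ≡ᵇ u ⟧ * F v u) ≡ F a b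
∑∑-pick N a b F a<N b<N = begin
  ∑∑ N (λ v u → ⟦ a ≡ᵇ v ⟧ * ⟦ b ≡ᵇ u ⟧ * F v u)
    ≡⟨ ∑-cong (upTo N) (λ v → trans (∑-cong (upTo N) (λ u → ℚ.*-assoc ⟦ a ≡ᵇ v ⟧ _ _)) (∑-*ˡ (upTo N) ⟦ a ≡ᵇ v ⟧ (λ u → ⟦ b ≡ᵇ u ⟧ * F v u))) ⟩
  ∑< N (λ v → ⟦ a ≡ᵇ v ⟧ * ∑< N (λ u → ⟦ b ≡ᵇ u ⟧ * F v u))
    ≡⟨ ∑<-pick N a (λ v → ∑< N (λ u → ⟦ b ≡ᵇ u ⟧ * F v u)) a<N ⟩
  ∑< N (λ u → ⟦ b ≡ᵇ u ⟧ * F a u)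
    ≡⟨ ∑<-pick N b (F a) b<N ⟩
  F a b ∎
  where open ≡-Reasoning

-- The bridge from Boolean adjacency to the edge list: each edge is met exactly once in each
-- direction. `F v u = h v` gives the handshake formula `∑-degree`, and `F v u = Y v * (X v - X u)`
-- gives the summation by parts in `potential`.
∑∑-adj : ∀ N es → All (IsEdge N) es → AllPairs Distinct es → ∀ (F : ℕ → ℕ → ℚ) →
  ∑∑ N (λ v u → ⟦ adj es v u ⟧ * F v u) ≡ ∑ es (λ (a , b) → F a b + F b a)
∑∑-adj N []              []                         []          F =
  trans (∑∑-cong N (λ v u → ℚ.*-zeroˡ (F v u))) (trans (∑-cong (upTo N) (λ _ → ∑-zero (upTo N))) (∑-zero (upTo N)))
∑∑-adj N ((a , b) ∷ es) ((a<N , b<N , a≢b) ∷ es✓) (e# ∷ es#) F = begin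
  ∑∑ N (λ v u → ⟦ adj ((a , b) ∷ es) v u ⟧ * F v u)
    ≡⟨ ∑∑-cong N (λ v u → trans (cong (_* F v u) (trans (⟦any⟧ (a , b) es v u e#) (cong (_+ ⟦ adj es v u ⟧) (⟦joins⟧ a b v u a≢b))))
         (lem (⟦ a ≡ᵇ v ⟧ * ⟦ b ≡ᵇ u ⟧) (⟦ b ≡ᵇ v ⟧ * ⟦ a ≡ᵇ u ⟧) ⟦ adj es v u ⟧ (F v u))) ⟩
  ∑∑ N (λ v u → (⟦ a ≡ᵇ v ⟧ * ⟦ b ≡ᵇ u ⟧ * F v u + ⟦ b ≡ᵇ v ⟧ * ⟦ a ≡ᵇ u ⟧ * F v u) + ⟦ adj es v u ⟧ * F v u)
    ≡⟨ trans (∑∑-+ N (λ v u → ⟦ a ≡ᵇ v ⟧ * ⟦ b ≡ᵇ u ⟧ * F v u + ⟦ b ≡ᵇ v ⟧ * ⟦ a ≡ᵇ u ⟧ * F v u) (λ v u → ⟦ adj es v u ⟧ * F v u))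
         (cong (_+ ∑∑ N (λ v u → ⟦ adj es v u ⟧ * F v u))
           (∑∑-+ N (λ v u → ⟦ a ≡ᵇ v ⟧ * ⟦ b ≡ᵇ u ⟧ * F v u) (λ v u → ⟦ b ≡ᵇ v ⟧ * ⟦ a ≡ᵇ u ⟧ * F v u))) ⟩
  (∑∑ N (λ v u → ⟦ a ≡ᵇ v ⟧ * ⟦ b ≡ᵇ u ⟧ * F v u) + ∑∑ N (λ v u → ⟦ b ≡ᵇ v ⟧ * ⟦ a ≡ᵇ u ⟧ * F v u))
    + ∑∑ N (λ v u → ⟦ adj es v u ⟧ * F v u)
    ≡⟨ cong₂ _+_ (cong₂ _+_ (∑∑-pick N a b F a<N b<N) (∑∑-pick N b a F b<N a<N)) (∑∑-adj N es es✓ es# F) ⟩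
  (F a b + F b a) + ∑ es (λ (a , b) → F a b + F b a) ∎
  where
  open ≡-Reasoning
  lem : ∀ p q r f → ((p + q) + r) * f ≡ (p * f + q * f) + r * f
  lem = solve-∀ ℚ-ring

degree : ℕ → List (ℕ × ℕ) → ℕ → ℚ
degree N es v = ∑< N (λ u → ⟦ adj es v u ⟧)

fromℕ-deg : ∀ {N} es (v : Fin N) → fromℕ (deg (fromEdges {N} es) v) ≡ degree N es (toℕ v)
fromℕ-deg {N} es v = trans (go (allFin N)) (∑-allFin N (λ u → ⟦ adj es (toℕ v) u ⟧))
  where
  cast : ∀ b → fromℕ (if b then 1 else 0) ≡ ⟦ b ⟧
  cast true  = refl
  cast false = refl
  go : ∀ us → fromℕ (foldr (λ u acc → (if adj es (toℕ v) (toℕ u) then 1 else 0) ℕ.+ acc) 0 us)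
    ≡ ∑ us (λ u → ⟦ adj es (toℕ v) (toℕ u) ⟧)
  go []       = refl
  go (u ∷ us) = trans (fromℕ-+ (if b then 1 else 0) _) (cong₂ _+_ (cast b) (go us))
    where b = adj es (toℕ v) (toℕ u)

-- The network equations L x = e_i - e_j in weak form, with Y as the test function.
record IsPotential (es : List (ℕ × ℕ)) (i j : ℕ) (x : ℕ → ℚ) : Set where
  field weak : ∀ (Y : ℕ → ℚ) → ∑ es (λ (a , b) → (Y a - Y b) * (x a - x b)) ≡ Y i - Y j
open IsPotential

-- Carries potentials over to labels in ℕ. The default 0 is never seen, because all edges, sources
-- and sinks lie below `N`.
extend : ∀ {N} → (Fin N → ℚ) → ℕ → ℚ
extend {N} x k with k ℕ.<? N
... | yes k<N = x (fromℕ< k<N)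
... | no  _   = 0ℚ

extend-toℕ : ∀ {N} (x : Fin N → ℚ) i → extend x (toℕ i) ≡ x i
extend-toℕ {N} x i with toℕ i ℕ.<? N
... | yes i<N = cong x (Fin.fromℕ<-toℕ i i<N)
... | no  i≮N = ⊥-elim (i≮N (Fin.toℕ<n i))

module _ {N : ℕ} (es : List (ℕ × ℕ)) (es✓ : All (IsEdge N) es) (es# : AllPairs Distinct es) where

  ∑-degree : ∀ (h : ℕ → ℚ) → ∑< N (λ v → degree N es v * h v) ≡ ∑ es (λ (a , b) → h a + h b)
  ∑-degree h = trans (∑-cong (upTo N) (λ v → sym (∑-*ʳ (upTo N) (h v) (λ u → ⟦ adj es v u ⟧)))) (∑∑-adj N es es✓ es# (λ v _ → h v))

  lap-degree : ∀ x (v : Fin N) → lap (fromEdges es) x v ≡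
    ∑< N (λ u → ⟦ adj es (toℕ v) u ⟧ * (extend x (toℕ v) - extend x u))
  lap-degree x v = begin
    fromℕ (deg (fromEdges {N} es) v) * x v - Σ (λ u → if adj es (toℕ v) (toℕ u) then x u else 0ℚ)
      ≡⟨ cong₂ _-_ (cong₂ _*_ (fromℕ-deg es v) (sym (extend-toℕ x v)))
           (trans (trans (∑-foldr (allFin N) _) (∑-cong (allFin N) (λ u → trans (ind (adj es (toℕ v) (toℕ u)) (x u)) (cong (⟦ adj es (toℕ v) (toℕ u) ⟧ *_) (sym (extend-toℕ x u))))))
             (∑-allFin N (λ u → ⟦ adj es (toℕ v) u ⟧ * extend x u))) ⟩
    degree N es (toℕ v) * extend x (toℕ v) - ∑< N (λ u → ⟦ adj es (toℕ v) u ⟧ * extend x u)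
      ≡⟨ cong (_- ∑< N (λ u → ⟦ adj es (toℕ v) u ⟧ * extend x u)) (sym (∑-*ʳ (upTo N) (extend x (toℕ v)) (λ u → ⟦ adj es (toℕ v) u ⟧))) ⟩
    ∑< N (λ u → ⟦ adj es (toℕ v) u ⟧ * extend x (toℕ v)) - ∑< N (λ u → ⟦ adj es (toℕ v) u ⟧ * extend x u)
      ≡⟨ ∑-- (upTo N) (λ u → ⟦ adj es (toℕ v) u ⟧ * extend x (toℕ v)) (λ u → ⟦ adj es (toℕ v) u ⟧ * extend x u) ⟨
    ∑< N (λ u → ⟦ adj es (toℕ v) u ⟧ * extend x (toℕ v) - ⟦ adj es (toℕ v) u ⟧ * extend x u)
      ≡⟨ ∑-cong (upTo N) (λ u → lem ⟦ adj es (toℕ v) u ⟧ (extend x (toℕ v)) (extend x u)) ⟩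
    ∑< N (λ u → ⟦ adj es (toℕ v) u ⟧ * (extend x (toℕ v) - extend x u)) ∎
    where
    open ≡-Reasoning
    ind : ∀ b q → (if b then q else 0ℚ) ≡ ⟦ b ⟧ * q
    ind true  q = sym (ℚ.*-identityˡ q)
    ind false q = sym (ℚ.*-zeroˡ q)
    lem : ∀ a p q → a * p - a * q ≡ a * (p - q)
    lem = solve-∀ ℚ-ring

  -- Summation by parts: each edge term splits into a contribution of either end, and the
  -- contributions at a vertex v collect to `Y v` times the Laplacian of `x` at v, where the network
  -- equation applies.
  potential : ∀ (i j : Fin N) (x : Fin N → ℚ) → (∀ v → lap (fromEdges es) x v ≡ δ i v - δ j v) →
    IsPotential es (toℕ i) (toℕ j) (extend x)
  potential i j x eq .weak Y = begin
    ∑ es (λ (a , b) → (Y a - Y b) * (X a - X b))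
      ≡⟨ ∑-cong es (λ (a , b) → lem (Y a) (Y b) (X a) (X b)) ⟩
    ∑ es (λ (a , b) → Y a * (X a - X b) + Y b * (X b - X a))
      ≡⟨ ∑∑-adj N es es✓ es# (λ v u → Y v * (X v - X u)) ⟨
    ∑∑ N (λ v u → ⟦ adj es v u ⟧ * (Y v * (X v - X u)))
      ≡⟨ ∑-cong (upTo N) (λ v → trans (∑-cong (upTo N) (λ u → lem′ ⟦ adj es v u ⟧ (Y v) (X v - X u))) (∑-*ˡ (upTo N) (Y v) (λ u → ⟦ adj es v u ⟧ * (X v - X u)))) ⟩
    ∑< N (λ v → Y v * ∑< N (λ u → ⟦ adj es v u ⟧ * (X v - X u)))
      ≡⟨ ∑-allFin N (λ v → Y v * ∑< N (λ u → ⟦ adj es v u ⟧ * (X v - X u))) ⟨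
    ∑ (allFin N) (λ v → Y (toℕ v) * ∑< N (λ u → ⟦ adj es (toℕ v) u ⟧ * (X (toℕ v) - X u)))
      ≡⟨ ∑-cong (allFin N) (λ v → cong (Y (toℕ v) *_) (trans (sym (lap-degree x v)) (eq v))) ⟩
    ∑ (allFin N) (λ v → Y (toℕ v) * (δ i v - δ j v))
      ≡⟨ ∑-allFin N (λ v → Y v * (⟦ toℕ i ≡ᵇ v ⟧ - ⟦ toℕ j ≡ᵇ v ⟧)) ⟩
    ∑< N (λ v → Y v * (⟦ toℕ i ≡ᵇ v ⟧ - ⟦ toℕ j ≡ᵇ v ⟧))
      ≡⟨ ∑-cong (upTo N) (λ v → lem″ (Y v) ⟦ toℕ i ≡ᵇ v ⟧ ⟦ toℕ j ≡ᵇ v ⟧) ⟩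
    ∑< N (λ v → ⟦ toℕ i ≡ᵇ v ⟧ * Y v - ⟦ toℕ j ≡ᵇ v ⟧ * Y v)
      ≡⟨ ∑-- (upTo N) (λ v → ⟦ toℕ i ≡ᵇ v ⟧ * Y v) (λ v → ⟦ toℕ j ≡ᵇ v ⟧ * Y v) ⟩
    ∑< N (λ v → ⟦ toℕ i ≡ᵇ v ⟧ * Y v) - ∑< N (λ v → ⟦ toℕ j ≡ᵇ v ⟧ * Y v)
      ≡⟨ cong₂ _-_ (∑<-pick N (toℕ i) Y (Fin.toℕ<n i)) (∑<-pick N (toℕ j) Y (Fin.toℕ<n j)) ⟩
    Y (toℕ i) - Y (toℕ j) ∎
    where
    open ≡-Reasoning
    X = extend x
    lem : ∀ p q a b → (p - q) * (a - b) ≡ p * (a - b) + q * (b - a)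
    lem = solve-∀ ℚ-ring
    lem′ : ∀ a y d → a * (y * d) ≡ y * (a * d)
    lem′ = solve-∀ ℚ-ring
    lem″ : ∀ y a b → y * (a - b) ≡ a * y - b * y
    lem″ = solve-∀ ℚ-ring

-- Bounding the potential drop along an edge

step : ℚ → ℚ → ℚ
step t x with t ℚ.≤? x
... | yes _ = 1ℚ
... | no  _ = 0ℚ

step-≤1 : ∀ t x y → step t x - step t y ≤ 1ℚ
step-≤1 t x y with t ℚ.≤? x | t ℚ.≤? y
... | yes _ | yes _ = fromℕ-mono {0} {1} z≤n
... | yes _ | no  _ = ≤-refl
... | no  _ | yes _ = ℚ.*≤* ℤ.-≤+
... | no  _ | no  _ = fromℕ-mono {0} {1} z≤n

step-mono : ∀ t x y → 0ℚ ≤ (step t x - step t y) * (x - y)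
step-mono t x y with t ℚ.≤? x | t ℚ.≤? y
... | yes _   | yes _   = ≤-reflexive (sym (ℚ.*-zeroˡ (x - y)))
... | no  _   | no  _   = ≤-reflexive (sym (ℚ.*-zeroˡ (x - y)))
... | yes t≤x | no  t≰y = ≤-shift (≤-trans (ℚ.<⇒≤ (ℚ.≰⇒> t≰y)) t≤x) (lem x y)
  where
  lem : ∀ x y → (1ℚ - 0ℚ) * (x - y) - 0ℚ ≡ x - y
  lem = solve-∀ ℚ-ring
... | no  t≰x | yes t≤y = ≤-shift (≤-trans (ℚ.<⇒≤ (ℚ.≰⇒> t≰x)) t≤y) (lem x y)
  where
  lem : ∀ x y → (0ℚ - 1ℚ) * (x - y) - 0ℚ ≡ y - x
  lem = solve-∀ ℚ-ring

-- Testing with the indicator of a superlevel set of x shows that no edge carries more than the total current.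
potential-≤1 : ∀ {es i j x} → IsPotential es i j x → ∀ {a b} → (a , b) ∈ es → ∣ x a - x b ∣ ≤ 1ℚ
potential-≤1 {es} {i} {j} {x} pot {a} {b} e∈es = ∣∣-intro (bound a b (flow (x a)))
  (≤-trans (≤-reflexive (neg (x a) (x b))) (bound b a (≤-trans (≤-reflexive (flip (step (x b) (x a)) (step (x b) (x b)) (x a) (x b))) (flow (x b)))))
  where
  neg : ∀ p q → - (p - q) ≡ q - p
  neg = solve-∀ ℚ-ring
  flip : ∀ s t p q → (t - s) * (q - p) ≡ (s - t) * (p - q)
  flip = solve-∀ ℚ-ring
  flow : ∀ t → (step t (x a) - step t (x b)) * (x a - x b) ≤ 1ℚ
  flow t = ≤-trans (∑-member es _ (λ (c , d) → step-mono t (x c) (x d)) e∈es)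
    (≤-trans (≤-reflexive (weak pot (step t ∘ x))) (step-≤1 t (x i) (x j)))
  bound : ∀ c d → (step (x c) (x c) - step (x c) (x d)) * (x c - x d) ≤ 1ℚ → x c - x d ≤ 1ℚ
  bound c d f with x c ℚ.≤? x d | x c ℚ.≤? x c
  ... | yes c≤d | _      = ≤-trans (≤-shift c≤d (lem (x c) (x d))) (fromℕ-mono {0} {1} z≤n)
    where
    lem : ∀ p q → 0ℚ - (p - q) ≡ q - p
    lem = solve-∀ ℚ-ring
  ... | no  _   | yes _  = ≤-trans (≤-reflexive (sym (lem (x c - x d)))) f
    where
    lem : ∀ d → (1ℚ - 0ℚ) * d ≡ d
    lem = solve-∀ ℚ-ring
  ... | no  _   | no c≰c = ⊥-elim (c≰c ≤-refl)

-- Pentagonal chains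

-- tw selects the Möbius chain; m = 2n is the length of the rails u and u′.
module Chain (tw : Bool) (n l : ℕ) (2n≡m : 2 ℕ.* n ≡ suc l) (2≤l : 2 ℕ.≤ l) where

  m : ℕ
  m = suc l

  s t : ℕ
  s = if tw then m else 0
  t = if tw then 0 else m

  rail₁ rail₂ rung₁ rung₂ rung₃ : ℕ → ℕ × ℕ
  rail₁ i = i , suc i
  rail₂ i = m ℕ.+ i , m ℕ.+ suc i
  rung₁ k = 2 ℕ.* k , m ℕ.+ 2 ℕ.* k
  rung₂ k = suc (2 ℕ.* k) , m ℕ.+ m ℕ.+ k
  rung₃ k = m ℕ.+ m ℕ.+ k , m ℕ.+ suc (2 ℕ.* k)

  commons : List (ℕ × ℕ)
  commons = map rail₁ (upTo l) ++ map rail₂ (upTo l) ++ map rung₁ (upTo n) ++ map rung₂ (upTo n) ++ map rung₃ (upTo n)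

  edges : List (ℕ × ℕ)
  edges = (l , s) ∷ (m ℕ.+ l , t) ∷ commons

  N : ℕ
  N = m ℕ.+ m ℕ.+ n

  ∑-edges : ∀ φ → ∑ edges φ ≡ φ (l , s) + (φ (m ℕ.+ l , t) + (∑< l (φ ∘ rail₁) + (∑< l (φ ∘ rail₂)
    + (∑< n (φ ∘ rung₁) + (∑< n (φ ∘ rung₂) + ∑< n (φ ∘ rung₃))))))
  ∑-edges φ = cong (φ (l , s) +_) (cong (φ (m ℕ.+ l , t) +_)
    (split rail₁ l _ (split rail₂ l _ (split rung₁ n _ (split rung₂ n _ (∑-map rung₃ (upTo n) φ))))))
    where
    split : ∀ f k es {q} → ∑ es φ ≡ q → ∑ (map f (upTo k) ++ es) φ ≡ ∑< k (φ ∘ f) + q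
    split f k es eq = trans (∑-++ (map f (upTo k)) es φ) (cong₂ _+_ (∑-map f (upTo k) φ) eq)

  byRegion : ∀ {A : Set} → (f g h : ℕ → A) → ℕ → A
  byRegion f g h v with v ℕ.<? m | v ℕ.∸ m ℕ.<? m
  ... | yes _ | _     = f v
  ... | no  _ | yes _ = g (v ℕ.∸ m)
  ... | no  _ | no  _ = h (v ℕ.∸ (m ℕ.+ m))

  module _ {A : Set} (f g h : ℕ → A) where

    byRegion-u : ∀ {p} → p ℕ.< m → byRegion f g h p ≡ f p
    byRegion-u {p} p<m with p ℕ.<? m | p ℕ.∸ m ℕ.<? m
    ... | yes _   | _ = refl
    ... | no  p≮m | _ = ⊥-elim (p≮m p<m)

    byRegion-u′ : ∀ {p} → p ℕ.< m → byRegion f g h (m ℕ.+ p) ≡ g p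
    byRegion-u′ {p} p<m with m ℕ.+ p ℕ.<? m | m ℕ.+ p ℕ.∸ m ℕ.<? m
    ... | yes q | _     = ⊥-elim (ℕ.m+n≮m m p q)
    ... | no  _ | yes _ = cong g (ℕ.m+n∸m≡n m p)
    ... | no  _ | no  q = ⊥-elim (q (subst (ℕ._< m) (sym (ℕ.m+n∸m≡n m p)) p<m))

    byRegion-w : ∀ k → byRegion f g h (m ℕ.+ m ℕ.+ k) ≡ h k
    byRegion-w k with m ℕ.+ m ℕ.+ k ℕ.<? m | m ℕ.+ m ℕ.+ k ℕ.∸ m ℕ.<? m
    ... | yes q | _     = ⊥-elim (ℕ.m+n≮m m (m ℕ.+ k) (subst (ℕ._< m) (ℕ.+-assoc m m k) q))
    ... | no  _ | yes q = ⊥-elim (ℕ.m+n≮m m k (subst (ℕ._< m) (trans (cong (ℕ._∸ m) (ℕ.+-assoc m m k)) (ℕ.m+n∸m≡n m (m ℕ.+ k))) q))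
    ... | no  _ | no  _ = cong h (ℕ.m+n∸m≡n (m ℕ.+ m) k)

  data Vertex : ℕ → Set where
    u  : ∀ {p} → p ℕ.< m → Vertex p
    u′ : ∀ {p} → p ℕ.< m → Vertex (m ℕ.+ p)
    w  : ∀ {k} → k ℕ.< n → Vertex (m ℕ.+ m ℕ.+ k)

  vertex : ∀ {v} → v ℕ.< N → Vertex v
  vertex {v} v<N with ℕ.<-≤-connex v m
  ... | inj₁ v<m = u v<m
  ... | inj₂ m≤v with ℕ.<-≤-connex (v ℕ.∸ m) m
  ...   | inj₁ q = subst Vertex (ℕ.m+[n∸m]≡n m≤v) (u′ q)
  ...   | inj₂ q = subst Vertex (ℕ.m+[n∸m]≡n 2m≤v) (w (ℕ.+-cancelˡ-< (m ℕ.+ m) _ _ (subst (ℕ._< N) (sym (ℕ.m+[n∸m]≡n 2m≤v)) v<N)))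
    where
    2m≤v : m ℕ.+ m ℕ.≤ v
    2m≤v = subst (m ℕ.+ m ℕ.≤_) (ℕ.m+[n∸m]≡n m≤v) (ℕ.+-monoʳ-≤ m q)

  even< : ∀ {k} → k ℕ.< n → 2 ℕ.* k ℕ.< m
  even< {k} k<n = subst (2 ℕ.* k ℕ.<_) 2n≡m (ℕ.*-monoʳ-< 2 k<n)

  odd< : ∀ {k} → k ℕ.< n → suc (2 ℕ.* k) ℕ.< m
  odd< {k} k<n = subst₂ ℕ._≤_ (ℕ.*-suc 2 k) 2n≡m (ℕ.*-monoʳ-≤ 2 k<n)

  data Parity : ℕ → Set where
    even : ∀ {k} → k ℕ.< n → Parity (2 ℕ.* k)
    odd  : ∀ {k} → k ℕ.< n → Parity (suc (2 ℕ.* k))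

  halve : ∀ p → ∃ λ k → p ≡ 2 ℕ.* k ⊎ p ≡ suc (2 ℕ.* k)
  halve zero    = 0 , inj₁ refl
  halve (suc p) with halve p
  ... | k , inj₁ eq = k , inj₂ (cong suc eq)
  ... | k , inj₂ eq = suc k , inj₁ (trans (cong suc eq) (sym (ℕ.*-suc 2 k)))

  parity : ∀ {p} → p ℕ.< m → Parity p
  parity {p} p<m with halve p
  ... | k , inj₁ refl = even (ℕ.*-cancelˡ-< 2 k n (subst (2 ℕ.* k ℕ.<_) (sym 2n≡m) p<m))
  ... | k , inj₂ refl = odd (ℕ.*-cancelˡ-< 2 k n (ℕ.<-trans (ℕ.n<1+n (2 ℕ.* k)) (subst (suc (2 ℕ.* k) ℕ.<_) (sym 2n≡m) p<m)))

  pos : ℕ → ℕ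
  pos = byRegion id id (λ k → suc (2 ℕ.* k))

  pos-u : ∀ {p} → p ℕ.< m → pos p ≡ p
  pos-u = byRegion-u id id (λ k → suc (2 ℕ.* k))

  pos-u′ : ∀ {p} → p ℕ.< m → pos (m ℕ.+ p) ≡ p
  pos-u′ = byRegion-u′ id id (λ k → suc (2 ℕ.* k))

  pos-m : pos m ≡ 0
  pos-m = trans (cong pos (sym (ℕ.+-identityʳ m))) (pos-u′ (s≤s z≤n))

  pos-w : ∀ k → pos (m ℕ.+ m ℕ.+ k) ≡ suc (2 ℕ.* k)
  pos-w = byRegion-w id id (λ k → suc (2 ℕ.* k))

  pos<m : ∀ {v} → v ℕ.< N → pos v ℕ.< m
  pos<m v<N with vertex v<N
  ... | u p<m     = subst (ℕ._< m) (sym (pos-u p<m)) p<m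
  ... | u′ p<m    = subst (ℕ._< m) (sym (pos-u′ p<m)) p<m
  ... | w {k} k<n = subst (ℕ._< m) (sym (pos-w k)) (odd< k<n)

  rail₁∈ : ∀ {i} → i ℕ.< l → rail₁ i ∈ edges
  rail₁∈ i<l = there (there (∈-++⁺ˡ (∈-map⁺ rail₁ (∈-upTo⁺ i<l))))

  rail₂∈ : ∀ {i} → i ℕ.< l → rail₂ i ∈ edges
  rail₂∈ i<l = there (there (∈-++⁺ʳ (map rail₁ (upTo l)) (∈-++⁺ˡ (∈-map⁺ rail₂ (∈-upTo⁺ i<l)))))

  rung∈ : ∀ {e} → e ∈ (map rung₁ (upTo n) ++ map rung₂ (upTo n) ++ map rung₃ (upTo n)) → e ∈ edges
  rung∈ e∈ = there (there (∈-++⁺ʳ (map rail₁ (upTo l)) (∈-++⁺ʳ (map rail₂ (upTo l)) e∈)))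

  rung₁∈ : ∀ {k} → k ℕ.< n → rung₁ k ∈ edges
  rung₁∈ k<n = rung∈ (∈-++⁺ˡ (∈-map⁺ rung₁ (∈-upTo⁺ k<n)))

  rung₂∈ : ∀ {k} → k ℕ.< n → rung₂ k ∈ edges
  rung₂∈ k<n = rung∈ (∈-++⁺ʳ (map rung₁ (upTo n)) (∈-++⁺ˡ (∈-map⁺ rung₂ (∈-upTo⁺ k<n))))

  rung₃∈ : ∀ {k} → k ℕ.< n → rung₃ k ∈ edges
  rung₃∈ k<n = rung∈ (∈-++⁺ʳ (map rung₁ (upTo n)) (∈-++⁺ʳ (map rung₂ (upTo n)) (∈-map⁺ rung₃ (∈-upTo⁺ k<n))))

  All-map : ∀ {P : ℕ × ℕ → Set} {f k} → (∀ {i} → i ℕ.< k → P (f i)) → All P (map f (upTo k))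
  All-map h = All.map⁺ (All.applyUpTo⁺₁ id _ h)

  All-commons : ∀ {P : ℕ × ℕ → Set} →
    (∀ {i} → i ℕ.< l → P (rail₁ i)) → (∀ {i} → i ℕ.< l → P (rail₂ i)) →
    (∀ {k} → k ℕ.< n → P (rung₁ k)) → (∀ {k} → k ℕ.< n → P (rung₂ k)) → (∀ {k} → k ℕ.< n → P (rung₃ k)) →
    All P commons
  All-commons a b c d e = All.++⁺ (All-map a) (All.++⁺ (All-map b) (All.++⁺ (All-map c) (All.++⁺ (All-map d) (All-map e))))

  u<N : ∀ {p} → p ℕ.< m → p ℕ.< N
  u<N {p} p<m = ℕ.<-≤-trans p<m (ℕ.≤-trans (ℕ.m≤m+n m m) (ℕ.m≤m+n (m ℕ.+ m) n))

  u′<N : ∀ {p} → p ℕ.< m → m ℕ.+ p ℕ.< N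
  u′<N p<m = ℕ.<-≤-trans (ℕ.+-monoʳ-< m p<m) (ℕ.m≤m+n (m ℕ.+ m) n)

  w<N : ∀ {k} → k ℕ.< n → m ℕ.+ m ℕ.+ k ℕ.< N
  w<N = ℕ.+-monoʳ-< (m ℕ.+ m)

  l<m : l ℕ.< m
  l<m = ℕ.n<1+n l

  edges✓ : All (IsEdge N) edges
  edges✓ = wrap₁ tw ∷ wrap₂ tw ∷ All-commons
    (λ i<l → u<N (ℕ.m<n⇒m<1+n i<l) , u<N (s≤s i<l) , ℕ.1+n≢n ∘ sym)
    (λ i<l → u′<N (ℕ.m<n⇒m<1+n i<l) , u′<N (s≤s i<l) , ℕ.1+n≢n ∘ sym ∘ ℕ.+-cancelˡ-≡ m _ _)
    (λ {k} k<n → u<N (even< k<n) , u′<N (even< k<n) , ℕ.<⇒≢ (ℕ.m<n+m (2 ℕ.* k) (s≤s (z≤n {l}))))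
    (λ {k} k<n → u<N (odd< k<n) , w<N k<n , ℕ.<⇒≢ (ℕ.<-≤-trans (odd< k<n) (ℕ.≤-trans (ℕ.m≤m+n m m) (ℕ.m≤m+n (m ℕ.+ m) k))))
    (λ {k} k<n → w<N k<n , u′<N (odd< k<n) , ℕ.<⇒≢ (ℕ.<-≤-trans (ℕ.+-monoʳ-< m (odd< k<n)) (ℕ.m≤m+n (m ℕ.+ m) k)) ∘ sym)
    where
    0<l : 0 ℕ.< l
    0<l = ℕ.<-≤-trans (s≤s z≤n) 2≤l
    m<N : m ℕ.< N
    m<N = subst (ℕ._< N) (ℕ.+-identityʳ m) (u′<N (s≤s z≤n))
    wrap₁ : ∀ tw → IsEdge N (l , (if tw then m else 0))
    wrap₁ true  = u<N l<m , m<N , ℕ.<⇒≢ l<m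
    wrap₁ false = u<N l<m , u<N (s≤s z≤n) , ℕ.<⇒≢ 0<l ∘ sym
    wrap₂ : ∀ tw → IsEdge N (m ℕ.+ l , (if tw then 0 else m))
    wrap₂ true  = u′<N l<m , u<N (s≤s z≤n) , λ ()
    wrap₂ false = u′<N l<m , m<N , ℕ.<⇒≢ (ℕ.m<m+n m 0<l) ∘ sym

  -- A symmetric function of the two ends is an invariant of the unordered pair, so different values
  -- separate edges. The invariants used are the sum of region weights, the sum of the labels and
  -- their distance.
  distinct : (K : ℕ → ℕ → ℕ) → (∀ a b → K a b ≡ K b a) → ∀ {a b c d} → K a b ≢ K c d → Distinct (a , b) (c , d)
  distinct K K-sym {a} {b} {c} {d} K≢ .¬both i j p q = K≢ (trans (key a b p) (sym (key c d q)))
    where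
    key : ∀ a b → joins (a , b) i j ≡ true → K a b ≡ K i j
    key a b r with joins-elim a b i j r
    ... | inj₁ (refl , refl) = refl
    ... | inj₂ (refl , refl) = K-sym a b

  -- The regions are weighted so that the five families of edges have different tags.
  weight : ℕ → ℕ
  weight = byRegion (λ _ → 0) (λ _ → 1) (λ _ → 4)

  tag : ℕ × ℕ → ℕ
  tag (a , b) = weight a ℕ.+ weight b

  weight-u : ∀ {p} → p ℕ.< m → weight p ≡ 0
  weight-u = byRegion-u (λ _ → 0) (λ _ → 1) (λ _ → 4)

  weight-u′ : ∀ {p} → p ℕ.< m → weight (m ℕ.+ p) ≡ 1
  weight-u′ = byRegion-u′ (λ _ → 0) (λ _ → 1) (λ _ → 4)

  weight-w : ∀ k → weight (m ℕ.+ m ℕ.+ k) ≡ 4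
  weight-w = byRegion-w (λ _ → 0) (λ _ → 1) (λ _ → 4)

  tag-rail₁ : ∀ {i} → i ℕ.< l → tag (rail₁ i) ≡ 0
  tag-rail₁ i<l = cong₂ ℕ._+_ (weight-u (ℕ.m<n⇒m<1+n i<l)) (weight-u (s≤s i<l))

  tag-rail₂ : ∀ {i} → i ℕ.< l → tag (rail₂ i) ≡ 2
  tag-rail₂ i<l = cong₂ ℕ._+_ (weight-u′ (ℕ.m<n⇒m<1+n i<l)) (weight-u′ (s≤s i<l))

  tag-rung₁ : ∀ {k} → k ℕ.< n → tag (rung₁ k) ≡ 1
  tag-rung₁ k<n = cong₂ ℕ._+_ (weight-u (even< k<n)) (weight-u′ (even< k<n))

  tag-rung₂ : ∀ {k} → k ℕ.< n → tag (rung₂ k) ≡ 4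
  tag-rung₂ {k} k<n = cong₂ ℕ._+_ (weight-u (odd< k<n)) (weight-w k)

  tag-rung₃ : ∀ {k} → k ℕ.< n → tag (rung₃ k) ≡ 5
  tag-rung₃ {k} k<n = cong₂ ℕ._+_ (weight-w k) (weight-u′ (odd< k<n))

  byTag : ∀ {e e′ p q} → tag e ≡ p → tag e′ ≡ q → p ≢ q → Distinct e e′
  byTag refl refl = distinct (λ a b → weight a ℕ.+ weight b) (λ a b → ℕ.+-comm (weight a) (weight b))

  bySum : ∀ {a b c d} → a ℕ.+ b ℕ.< c ℕ.+ d → Distinct (a , b) (c , d)
  bySum lt = distinct ℕ._+_ ℕ.+-comm (ℕ.<⇒≢ lt)

  byLength : ∀ {a b c d} p q → ℕ.∣ a - b ∣ ≡ p → ℕ.∣ c - d ∣ ≡ q → p ≢ q → Distinct (a , b) (c , d)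
  byLength p q refl refl = distinct ℕ.∣_-_∣ ℕ.∣-∣-comm

  length-rail₁ : ∀ i → ℕ.∣ i - suc i ∣ ≡ 1
  length-rail₁ i = trans (cong ℕ.∣ i -_∣ (ℕ.+-comm 1 i)) (ℕ.∣m-m+n∣≡n i 1)

  length-rail₂ : ∀ i → ℕ.∣ m ℕ.+ i - m ℕ.+ suc i ∣ ≡ 1
  length-rail₂ i = trans (ℕ.∣m+n-m+o∣≡∣n-o∣ m i (suc i)) (length-rail₁ i)

  length-rung₁ : ∀ k → ℕ.∣ 2 ℕ.* k - m ℕ.+ 2 ℕ.* k ∣ ≡ m
  length-rung₁ k = trans (cong ℕ.∣ 2 ℕ.* k -_∣ (ℕ.+-comm m (2 ℕ.* k))) (ℕ.∣m-m+n∣≡n (2 ℕ.* k) m)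

  weight-0 : weight 0 ≡ 0
  weight-0 = weight-u (s≤s z≤n)

  weight-l : weight l ≡ 0
  weight-l = weight-u l<m

  weight-m : weight m ≡ 1
  weight-m = trans (cong weight (sym (ℕ.+-identityʳ m))) (weight-u′ (s≤s z≤n))

  weight-m+l : weight (m ℕ.+ l) ≡ 1
  weight-m+l = weight-u′ l<m

  l≢1 : l ≢ 1
  l≢1 = ℕ.<⇒≢ 2≤l ∘ sym

  l≢0 : l ≢ 0
  l≢0 = ℕ.<⇒≢ (ℕ.<-≤-trans (s≤s z≤n) 2≤l) ∘ sym

  -- The tag separates a wrap from every family except the one joining the same regions: `rung₁` for
  -- the Möbius chain, the rail on the same side for the cylinder. There the label distances differ.
  -- In the cylinder this needs `l ≢ 1`, since a rail with only two vertices would be closed by its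
  -- own edge.
  wraps-distinct : ∀ tw → All (Distinct (l , (if tw then m else 0))) ((m ℕ.+ l , (if tw then 0 else m)) ∷ commons)
    × All (Distinct (m ℕ.+ l , (if tw then 0 else m))) commons
  wraps-distinct true  =
      byLength 1 (m ℕ.+ l) (length-rail₁ l) refl (l≢0 ∘ ℕ.m+n≡0⇒m≡0 l ∘ sym ∘ ℕ.suc-injective) ∷ All-commons
        (λ i<l → byTag (cong₂ ℕ._+_ weight-l weight-m) (tag-rail₁ i<l) λ ())
        (λ i<l → byTag (cong₂ ℕ._+_ weight-l weight-m) (tag-rail₂ i<l) λ ())
        (λ {k} _ → byLength 1 m (length-rail₁ l) (length-rung₁ k) (l≢0 ∘ sym ∘ ℕ.suc-injective))
        (λ k<n → byTag (cong₂ ℕ._+_ weight-l weight-m) (tag-rung₂ k<n) λ ())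
        (λ k<n → byTag (cong₂ ℕ._+_ weight-l weight-m) (tag-rung₃ k<n) λ ())
    , All-commons
        (λ i<l → byTag (cong₂ ℕ._+_ weight-m+l weight-0) (tag-rail₁ i<l) λ ())
        (λ i<l → byTag (cong₂ ℕ._+_ weight-m+l weight-0) (tag-rail₂ i<l) λ ())
        (λ {k} _ → byLength (m ℕ.+ l) m refl (length-rung₁ k) (ℕ.<⇒≢ (ℕ.m<m+n m (ℕ.n≢0⇒n>0 l≢0)) ∘ sym))
        (λ k<n → byTag (cong₂ ℕ._+_ weight-m+l weight-0) (tag-rung₂ k<n) λ ())
        (λ k<n → byTag (cong₂ ℕ._+_ weight-m+l weight-0) (tag-rung₃ k<n) λ ())
  wraps-distinct false =
      byTag (cong₂ ℕ._+_ weight-l weight-0) (cong₂ ℕ._+_ weight-m+l weight-m) (λ ()) ∷ All-commons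
        (λ {i} _ → byLength l 1 (ℕ.∣-∣-identityʳ l) (length-rail₁ i) l≢1)
        (λ i<l → byTag (cong₂ ℕ._+_ weight-l weight-0) (tag-rail₂ i<l) λ ())
        (λ k<n → byTag (cong₂ ℕ._+_ weight-l weight-0) (tag-rung₁ k<n) λ ())
        (λ k<n → byTag (cong₂ ℕ._+_ weight-l weight-0) (tag-rung₂ k<n) λ ())
        (λ k<n → byTag (cong₂ ℕ._+_ weight-l weight-0) (tag-rung₃ k<n) λ ())
    , All-commons
        (λ i<l → byTag (cong₂ ℕ._+_ weight-m+l weight-m) (tag-rail₁ i<l) λ ())
        (λ {i} _ → byLength l 1 (trans (ℕ.∣-∣-comm (m ℕ.+ l) m) (ℕ.∣m-m+n∣≡n m l)) (length-rail₂ i) l≢1)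
        (λ k<n → byTag (cong₂ ℕ._+_ weight-m+l weight-m) (tag-rung₁ k<n) λ ())
        (λ k<n → byTag (cong₂ ℕ._+_ weight-m+l weight-m) (tag-rung₂ k<n) λ ())
        (λ k<n → byTag (cong₂ ℕ._+_ weight-m+l weight-m) (tag-rung₃ k<n) λ ())

  -- Within one family the sum of the end labels increases strictly with the index; between families
  -- the tags differ.
  edges# : AllPairs Distinct edges
  edges# = proj₁ (wraps-distinct tw) ∷ proj₂ (wraps-distinct tw) ∷
    AllPairs.++⁺ (increasing (λ i<j → ℕ.+-mono-< i<j (s≤s i<j))) (
    AllPairs.++⁺ (increasing (λ i<j → ℕ.+-mono-< (ℕ.+-monoʳ-< m i<j) (ℕ.+-monoʳ-< m (s≤s i<j)))) (
    AllPairs.++⁺ (increasing (λ i<j → ℕ.+-mono-< (ℕ.*-monoʳ-< 2 i<j) (ℕ.+-monoʳ-< m (ℕ.*-monoʳ-< 2 i<j)))) (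
    AllPairs.++⁺ (increasing (λ i<j → ℕ.+-mono-< (s≤s (ℕ.*-monoʳ-< 2 i<j)) (ℕ.+-monoʳ-< (m ℕ.+ m) i<j)))
      (increasing (λ i<j → ℕ.+-mono-< (ℕ.+-monoʳ-< (m ℕ.+ m) i<j) (ℕ.+-monoʳ-< m (s≤s (ℕ.*-monoʳ-< 2 i<j)))))
      (All-map λ p → All-map λ q → byTag (tag-rung₂ p) (tag-rung₃ q) λ ()))
      (All-map λ p → All.++⁺ (All-map λ q → byTag (tag-rung₁ p) (tag-rung₂ q) λ ())
        (All-map λ q → byTag (tag-rung₁ p) (tag-rung₃ q) λ ())))
      (All-map λ p → All.++⁺ (All-map λ q → byTag (tag-rail₂ p) (tag-rung₁ q) λ ())
        (All.++⁺ (All-map λ q → byTag (tag-rail₂ p) (tag-rung₂ q) λ ())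
        (All-map λ q → byTag (tag-rail₂ p) (tag-rung₃ q) λ ()))))
      (All-map λ p → All.++⁺ (All-map λ q → byTag (tag-rail₁ p) (tag-rail₂ q) λ ())
        (All.++⁺ (All-map λ q → byTag (tag-rail₁ p) (tag-rung₁ q) λ ())
        (All.++⁺ (All-map λ q → byTag (tag-rail₁ p) (tag-rung₂ q) λ ())
        (All-map λ q → byTag (tag-rail₁ p) (tag-rung₃ q) λ ()))))
    where
    increasing : ∀ {f k} → (∀ {i j} → i ℕ.< j → proj₁ (f i) ℕ.+ proj₂ (f i) ℕ.< proj₁ (f j) ℕ.+ proj₂ (f j)) →
      AllPairs Distinct (map f (upTo k))
    increasing f-mono = AllPairs.map⁺ (AllPairs.applyUpTo⁺₁ id _ (λ i<j _ → bySum (f-mono i<j)))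

-- Resistances

module ChainResistance (tw : Bool) (n l : ℕ) (2n≡m : 2 ℕ.* n ≡ suc l) (2≤l : 2 ℕ.≤ l) where

  open Chain tw n l 2n≡m 2≤l

  ∑<-parity : ∀ (h : ℕ → ℚ) → ∑< m h ≡ ∑< n (λ k → h (2 ℕ.* k)) + ∑< n (λ k → h (suc (2 ℕ.* k)))
  ∑<-parity h = trans (cong (λ m → ∑< m h) (sym 2n≡m)) (∑<-double n h)

  -- Counted along edges, so that no single degree has to be computed. With `E` and `O` the sums of
  -- `h` over even and odd positions, the two rails and the wraps contribute 4 (E + O), `rung₁` adds
  -- 2 E, and `rung₂` and `rung₃` add 2 O each.
  ∑-degree-pos : ∀ (h : ℕ → ℚ) → ∑< N (λ v → degree N edges v * h (pos v)) ≡
    fromℕ 6 * ∑< n (λ k → h (2 ℕ.* k)) + fromℕ 8 * ∑< n (λ k → h (suc (2 ℕ.* k)))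
  ∑-degree-pos h = begin
    ∑< N (λ v → degree N edges v * h (pos v))
      ≡⟨ ∑-degree edges edges✓ edges# (h ∘ pos) ⟩
    ∑ edges φ
      ≡⟨ ∑-edges φ ⟩
    φ (l , s) + (φ (m ℕ.+ l , t) + (∑< l (φ ∘ rail₁) + (∑< l (φ ∘ rail₂)
      + (∑< n (φ ∘ rung₁) + (∑< n (φ ∘ rung₂) + ∑< n (φ ∘ rung₃))))))
      ≡⟨ cong₂ _+_ (wrap₁ tw) (cong₂ _+_ (wrap₂ tw) (cong₂ _+_ rails₁ (cong₂ _+_ rails₂ (cong₂ _+_ rungs₁ (cong₂ _+_ rungs₂ rungs₃))))) ⟩
    (h l + h 0) + ((h l + h 0) + (B + (B + ((E + E) + ((O + O) + (O + O))))))
      ≡⟨ regroup (h l) (h 0) A A′ B E O (∑-+ (upTo l) h (h ∘ suc))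
           (trans (sym (∑<-parity h)) (∑<-last l h)) (trans (sym (∑<-parity h)) (∑<-suc l h)) ⟩
    fromℕ 6 * E + fromℕ 8 * O ∎
    where
    open ≡-Reasoning
    φ : ℕ × ℕ → ℚ
    φ (a , b) = h (pos a) + h (pos b)
    A = ∑< l h
    A′ = ∑< l (h ∘ suc)
    B = ∑< l (λ i → h i + h (suc i))
    E = ∑< n (λ k → h (2 ℕ.* k))
    O = ∑< n (λ k → h (suc (2 ℕ.* k)))
    φ-pos : ∀ a b {p q} → pos a ≡ p → pos b ≡ q → φ (a , b) ≡ h p + h q
    φ-pos a b refl refl = refl
    wrap₁ : ∀ tw → φ (l , (if tw then m else 0)) ≡ h l + h 0
    wrap₁ true  = φ-pos l m (pos-u l<m) pos-m
    wrap₁ false = φ-pos l 0 (pos-u l<m) (pos-u (s≤s z≤n))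
    wrap₂ : ∀ tw → φ (m ℕ.+ l , (if tw then 0 else m)) ≡ h l + h 0
    wrap₂ true  = φ-pos (m ℕ.+ l) 0 (pos-u′ l<m) (pos-u (s≤s z≤n))
    wrap₂ false = φ-pos (m ℕ.+ l) m (pos-u′ l<m) pos-m
    rails₁ : ∑< l (φ ∘ rail₁) ≡ B
    rails₁ = ∑<-cong l (λ i i<l → φ-pos i (suc i) (pos-u (ℕ.m<n⇒m<1+n i<l)) (pos-u (s≤s i<l)))
    rails₂ : ∑< l (φ ∘ rail₂) ≡ B
    rails₂ = ∑<-cong l (λ i i<l → φ-pos (m ℕ.+ i) (m ℕ.+ suc i) (pos-u′ (ℕ.m<n⇒m<1+n i<l)) (pos-u′ (s≤s i<l)))
    rungs₁ : ∑< n (φ ∘ rung₁) ≡ E + E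
    rungs₁ = trans (∑<-cong n (λ k k<n → φ-pos (2 ℕ.* k) (m ℕ.+ 2 ℕ.* k) (pos-u (even< k<n)) (pos-u′ (even< k<n)))) (∑-+ (upTo n) (λ k → h (2 ℕ.* k)) (λ k → h (2 ℕ.* k)))
    rungs₂ : ∑< n (φ ∘ rung₂) ≡ O + O
    rungs₂ = trans (∑<-cong n (λ k k<n → φ-pos (suc (2 ℕ.* k)) (m ℕ.+ m ℕ.+ k) (pos-u (odd< k<n)) (pos-w k))) (∑-+ (upTo n) (λ k → h (suc (2 ℕ.* k))) (λ k → h (suc (2 ℕ.* k))))
    rungs₃ : ∑< n (φ ∘ rung₃) ≡ O + O
    rungs₃ = trans (∑<-cong n (λ k k<n → φ-pos (m ℕ.+ m ℕ.+ k) (m ℕ.+ suc (2 ℕ.* k)) (pos-w k) (pos-u′ (odd< k<n)))) (∑-+ (upTo n) (λ k → h (suc (2 ℕ.* k))) (λ k → h (suc (2 ℕ.* k))))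
    regroup : ∀ h₁ h₀ A A′ B E O → B ≡ A + A′ → E + O ≡ A + h₁ → E + O ≡ h₀ + A′ →
      (h₁ + h₀) + ((h₁ + h₀) + (B + (B + ((E + E) + ((O + O) + (O + O)))))) ≡ fromℕ 6 * E + fromℕ 8 * O
    regroup h₁ h₀ A A′ B E O refl eq₁ eq₀ = trans (lem h₁ h₀ A A′ E O)
      (trans (cong₂ (λ p q → (p + p) + (q + q) + ((E + E) + ((O + O) + (O + O)))) (sym eq₁) (sym eq₀)) (lem′ E O))
      where
      lem : ∀ h₁ h₀ A A′ E O → (h₁ + h₀) + ((h₁ + h₀) + ((A + A′) + ((A + A′) + ((E + E) + ((O + O) + (O + O))))))
        ≡ ((A + h₁) + (A + h₁)) + ((h₀ + A′) + (h₀ + A′)) + ((E + E) + ((O + O) + (O + O)))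
      lem = solve-∀ ℚ-ring
      lem′ : ∀ E O → ((E + O) + (E + O)) + ((E + O) + (E + O)) + ((E + E) + ((O + O) + (O + O))) ≡ fromℕ 6 * E + fromℕ 8 * O
      lem′ = solve-∀ ℚ-ring

  -- Reduction of the network to a weighted-free cycle of section sums

  energy : (ℕ → ℚ) → (ℕ → ℚ) → ℕ × ℕ → ℚ
  energy g x (a , b) = (g (pos a) - g (pos b)) * (x a - x b)

  module _ (x : ℕ → ℚ) where

    Z : ℕ → ℚ
    Z p = x p + x (m ℕ.+ p)

    energy-level : ∀ g a b → pos a ≡ pos b → energy g x (a , b) ≡ 0ℚ
    energy-level g a b eq = trans (cong (λ p → (g p - g (pos b)) * (x a - x b)) eq) (lem (g (pos b)) (x a - x b))
      where
      lem : ∀ p d → (p - p) * d ≡ 0ℚ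
      lem = solve-∀ ℚ-ring

    energy-level-∑ : ∀ g f → (∀ {k} → k ℕ.< n → pos (proj₁ (f k)) ≡ pos (proj₂ (f k))) → ∑< n (energy g x ∘ f) ≡ 0ℚ
    energy-level-∑ g f eq = trans (∑<-cong n (λ k k<n → energy-level g (proj₁ (f k)) (proj₂ (f k)) (eq k<n))) (∑-zero (upTo n))

    energy-pos : ∀ g a b {p q} → pos a ≡ p → pos b ≡ q → energy g x (a , b) ≡ (g p - g q) * (x a - x b)
    energy-pos g a b refl refl = refl

    energy-rails : ∀ g → ∑< l (energy g x ∘ rail₁) + ∑< l (energy g x ∘ rail₂) ≡ ∑< l (λ p → (g p - g (suc p)) * (Z p - Z (suc p)))
    energy-rails g = trans (sym (∑-+ (upTo l) (energy g x ∘ rail₁) (energy g x ∘ rail₂))) (∑<-cong l (λ p p<l →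
      trans (cong₂ _+_ (energy-pos g p (suc p) (pos-u (ℕ.m<n⇒m<1+n p<l)) (pos-u (s≤s p<l)))
                       (energy-pos g (m ℕ.+ p) (m ℕ.+ suc p) (pos-u′ (ℕ.m<n⇒m<1+n p<l)) (pos-u′ (s≤s p<l))))
        (lem (g p - g (suc p)) (x p) (x (suc p)) (x (m ℕ.+ p)) (x (m ℕ.+ suc p)))))
      where
      lem : ∀ d a b a′ b′ → d * (a - b) + d * (a′ - b′) ≡ d * ((a + a′) - (b + b′))
      lem = solve-∀ ℚ-ring

    -- Both wraps run between positions `l` and 0 and carry the same factor `g l - g 0`; the twist
    -- only permutes the summands of the remaining differences.
    energy-wraps : ∀ g tw → energy g x (l , (if tw then m else 0)) + energy g x (m ℕ.+ l , (if tw then 0 else m)) ≡ (g l - g 0) * (Z l - Z 0)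
    energy-wraps g true  = trans (cong₂ _+_ (energy-pos g l m (pos-u l<m) pos-m) (energy-pos g (m ℕ.+ l) 0 (pos-u′ l<m) (pos-u (s≤s z≤n))))
      (trans (lem (g l - g 0) (x l) (x 0) (x (m ℕ.+ l)) (x m)) (cong (λ k → (g l - g 0) * (Z l - (x 0 + x k))) (sym (ℕ.+-identityʳ m))))
      where
      lem : ∀ d a b a′ b′ → d * (a - b′) + d * (a′ - b) ≡ d * ((a + a′) - (b + b′))
      lem = solve-∀ ℚ-ring
    energy-wraps g false = trans (cong₂ _+_ (energy-pos g l 0 (pos-u l<m) (pos-u (s≤s z≤n))) (energy-pos g (m ℕ.+ l) m (pos-u′ l<m) pos-m))
      (trans (lem (g l - g 0) (x l) (x 0) (x (m ℕ.+ l)) (x m)) (cong (λ k → (g l - g 0) * (Z l - (x 0 + x k))) (sym (ℕ.+-identityʳ m))))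
      where
      lem : ∀ d a b a′ b′ → d * (a - b) + d * (a′ - b′) ≡ d * ((a + a′) - (b + b′))
      lem = solve-∀ ℚ-ring

    energy-cycle : ∀ g → ∑ edges (energy g x) ≡
      ∑< l (λ p → (g p - g (suc p)) * (Z p - Z (suc p))) + (g l - g 0) * (Z l - Z 0)
    energy-cycle g = trans (∑-edges (energy g x)) (trans
      (cong (λ q → energy g x (l , s) + (energy g x (m ℕ.+ l , t) + (∑< l (energy g x ∘ rail₁) + (∑< l (energy g x ∘ rail₂) + q))))
        (cong₂ _+_ level₁ (cong₂ _+_ level₂ level₃)))
      (trans (lem (energy g x (l , s)) (energy g x (m ℕ.+ l , t)) (∑< l (energy g x ∘ rail₁)) (∑< l (energy g x ∘ rail₂)))
        (cong₂ _+_ (energy-rails g) (energy-wraps g tw))))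
      where
      lem : ∀ a b c d → a + (b + (c + (d + 0ℚ))) ≡ (c + d) + (a + b)
      lem = solve-∀ ℚ-ring
      level₁ = energy-level-∑ g rung₁ (λ k<n → trans (pos-u (even< k<n)) (sym (pos-u′ (even< k<n))))
      level₂ = energy-level-∑ g rung₂ (λ {k} k<n → trans (pos-u (odd< k<n)) (sym (pos-w k)))
      level₃ = energy-level-∑ g rung₃ (λ {k} k<n → trans (pos-w k) (sym (pos-u′ (odd< k<n))))

    -- Threshold `l` determines the drop d across the wrap through (1 + l) d = a - b; thresholds `a`
    -- and `b` then give `Z a` and `Z b` relative to `Z 0`. The factor m = 1 + l avoids a division,
    -- and a + b - 2 min (a, b) = e covers both orders of the two positions.
    Z-difference : ∀ {i j} → i ℕ.< N → j ℕ.< N → IsPotential edges i j x →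
      let e = fromℕ ℕ.∣ pos i - pos j ∣ in fromℕ m * (Z (pos i) - Z (pos j)) ≡ e * (fromℕ m - e)
    Z-difference {i} {j} i<N j<N pot = begin
      fromℕ m * (Z a - Z b)
        ≡⟨ cong (_* (Z a - Z b)) (fromℕ-suc l) ⟩
      (1ℚ + fromℕ l) * (Z a - Z b)
        ≡⟨ solve-system (Z a) (Z b) (Z 0) (Z l - Z 0) (fromℕ l) (fromℕ a) (fromℕ b) (fromℕ (a ℕ.⊓ b)) {fromℕ ℕ.∣ a - b ∣}
             at-a at-b at-l (fromℕ-∣-∣ a b) (fromℕ-∣-∣² a b) ⟩
      e * ((1ℚ + fromℕ l) - e)
        ≡⟨ cong (λ μ → e * (μ - e)) (fromℕ-suc l) ⟨
      e * (fromℕ m - e) ∎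
      where
      open ≡-Reasoning
      a = pos i
      b = pos j
      e = fromℕ ℕ.∣ a - b ∣
      a≤l : a ℕ.≤ l
      a≤l = ℕ.≤-pred (pos<m i<N)
      b≤l : b ℕ.≤ l
      b≤l = ℕ.≤-pred (pos<m j<N)
      clamp-energy : ∀ {c} → c ℕ.≤ l → (Z c - Z 0) + fromℕ c * (Z l - Z 0) ≡ fromℕ (a ℕ.⊓ c) - fromℕ (b ℕ.⊓ c)
      clamp-energy {c} c≤l = trans (sym (trans (energy-cycle (λ p → fromℕ (p ℕ.⊓ c)))
        (trans (cong₂ _+_ (∑<-clamp l c Z) refl)
          (trans (cong (λ d → (Z d - Z 0) + (fromℕ d - 0ℚ) * (Z l - Z 0)) (ℕ.m≥n⇒m⊓n≡n c≤l)) (lem (Z c - Z 0) (fromℕ c) (Z l - Z 0))))))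
        (weak pot (λ v → fromℕ (pos v ℕ.⊓ c)))
        where
        lem : ∀ p c d → p + (c - 0ℚ) * d ≡ p + c * d
        lem = solve-∀ ℚ-ring
      at-a : (Z a - Z 0) + fromℕ a * (Z l - Z 0) ≡ fromℕ a - fromℕ (a ℕ.⊓ b)
      at-a = trans (clamp-energy a≤l) (cong₂ (λ p q → fromℕ p - fromℕ q) (ℕ.⊓-idem a) (ℕ.⊓-comm b a))
      at-b : (Z b - Z 0) + fromℕ b * (Z l - Z 0) ≡ fromℕ (a ℕ.⊓ b) - fromℕ b
      at-b = trans (clamp-energy b≤l) (cong (λ q → fromℕ (a ℕ.⊓ b) - fromℕ q) (ℕ.⊓-idem b))
      at-l : (Z l - Z 0) + fromℕ l * (Z l - Z 0) ≡ fromℕ a - fromℕ b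
      at-l = trans (clamp-energy ℕ.≤-refl) (cong₂ (λ p q → fromℕ p - fromℕ q) (ℕ.m≤n⇒m⊓n≡m a≤l) (ℕ.m≤n⇒m⊓n≡m b≤l))
      solve-system : ∀ Za Zb Z₀ d l a b c {e} → (Za - Z₀) + a * d ≡ a - c → (Zb - Z₀) + b * d ≡ c - b →
        d + l * d ≡ a - b → a + b ≡ e + (c + c) → e * e ≡ (a - b) * (a - b) →
        (1ℚ + l) * (Za - Zb) ≡ e * ((1ℚ + l) - e)
      solve-system Za Zb Z₀ d l a b c {e} eqa eqb eql sum sq = begin
        (1ℚ + l) * (Za - Zb)
          ≡⟨ lem₁ Za Zb Z₀ d l a b ⟩
        (1ℚ + l) * (((Za - Z₀) + a * d) - ((Zb - Z₀) + b * d)) - (a - b) * (d + l * d)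
          ≡⟨ cong₂ _-_ (cong₂ (λ p q → (1ℚ + l) * (p - q)) eqa eqb) (cong ((a - b) *_) eql) ⟩
        (1ℚ + l) * ((a - c) - (c - b)) - (a - b) * (a - b)
          ≡⟨ cong₂ _-_ (lem₂ l a b c) (sym sq) ⟩
        (1ℚ + l) * ((a + b) - (c + c)) - e * e
          ≡⟨ cong (λ p → (1ℚ + l) * (p - (c + c)) - e * e) sum ⟩
        (1ℚ + l) * ((e + (c + c)) - (c + c)) - e * e
          ≡⟨ lem₃ l e c ⟩
        e * ((1ℚ + l) - e) ∎
        where
        lem₁ : ∀ Za Zb Z₀ d l a b → (1ℚ + l) * (Za - Zb) ≡
          (1ℚ + l) * (((Za - Z₀) + a * d) - ((Zb - Z₀) + b * d)) - (a - b) * (d + l * d)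
        lem₁ = solve-∀ ℚ-ring
        lem₂ : ∀ l a b c → (1ℚ + l) * ((a - c) - (c - b)) ≡ (1ℚ + l) * ((a + b) - (c + c))
        lem₂ = solve-∀ ℚ-ring
        lem₃ : ∀ l e c → (1ℚ + l) * ((e + (c + c)) - (c + c)) - e * e ≡ e * ((1ℚ + l) - e)
        lem₃ = solve-∀ ℚ-ring

    across : ∀ {i j} → IsPotential edges i j x → ∀ {p} → p ℕ.< m → ∣ x p - x (m ℕ.+ p) ∣ ≤ fromℕ 2
    across pot p<m with parity p<m
    ... | even k<n = ≤-trans (potential-≤1 pot (rung₁∈ k<n)) (fromℕ-mono {1} {2} (s≤s z≤n))
    ... | odd {k} k<n = ≤-trans (≤-reflexive (cong ∣_∣ (lem (x (suc (2 ℕ.* k))) (x (m ℕ.+ m ℕ.+ k)) (x (m ℕ.+ suc (2 ℕ.* k))))))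
        (∣∣-+ (x (suc (2 ℕ.* k)) - x (m ℕ.+ m ℕ.+ k)) (x (m ℕ.+ m ℕ.+ k) - x (m ℕ.+ suc (2 ℕ.* k))) (potential-≤1 pot (rung₂∈ k<n)) (potential-≤1 pot (rung₃∈ k<n)))
      where
      lem : ∀ a b c → a - c ≡ (a - b) + (b - c)
      lem = solve-∀ ℚ-ring

    -- For a rail vertex the difference is, up to sign, the drop across its position; for `w` it is
    -- made of the drops along the two edges at `w`.
    section-≈ : ∀ {i j v} → IsPotential edges i j x → v ℕ.< N → ∣ (x v + x v) - Z (pos v) ∣ ≤ fromℕ 2
    section-≈ pot v<N with vertex v<N
    ... | u {p} p<m = ≤-trans (≤-reflexive (cong ∣_∣ (trans (cong (λ q → (x p + x p) - Z q) (pos-u p<m)) (lem (x p) (x (m ℕ.+ p))))))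
        (across pot p<m)
      where
      lem : ∀ a b → (a + a) - (a + b) ≡ a - b
      lem = solve-∀ ℚ-ring
    ... | u′ {p} p<m = ≤-trans (≤-reflexive (trans (cong ∣_∣ (trans (cong (λ q → (x (m ℕ.+ p) + x (m ℕ.+ p)) - Z q) (pos-u′ p<m)) (lem (x p) (x (m ℕ.+ p)))))
          (ℚ.∣-p∣≡∣p∣ (x p - x (m ℕ.+ p)))))
        (across pot p<m)
      where
      lem : ∀ a b → (b + b) - (a + b) ≡ - (a - b)
      lem = solve-∀ ℚ-ring
    ... | w {k} k<n = ≤-trans (≤-reflexive (cong ∣_∣ (trans (cong (λ q → (x v + x v) - Z q) (pos-w k)) (lem (x v) (x (suc (2 ℕ.* k))) (x (m ℕ.+ suc (2 ℕ.* k)))))))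
        (∣∣-+ (- (x (suc (2 ℕ.* k)) - x v)) (x v - x (m ℕ.+ suc (2 ℕ.* k))) (≤-trans (≤-reflexive (ℚ.∣-p∣≡∣p∣ (x (suc (2 ℕ.* k)) - x v))) (potential-≤1 pot (rung₂∈ k<n))) (potential-≤1 pot (rung₃∈ k<n)))
      where
      v = m ℕ.+ m ℕ.+ k
      lem : ∀ b a c → (b + b) - (a + c) ≡ (- (a - b)) + (b - c)
      lem = solve-∀ ℚ-ring

    resistance-≈ : ∀ {i j} → i ℕ.< N → j ℕ.< N → IsPotential edges i j x →
      let e = fromℕ ℕ.∣ pos i - pos j ∣ in ∣ fromℕ 2 * fromℕ m * (x i - x j) - e * (fromℕ m - e) ∣ ≤ fromℕ 4 * fromℕ m
    resistance-≈ {i} {j} i<N j<N pot = ≤-trans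
      (≤-reflexive (cong ∣_∣ (trans (cong (λ ρ → fromℕ 2 * fromℕ m * (x i - x j) - ρ) (sym (Z-difference i<N j<N pot)))
        (lem (fromℕ m) (x i) (x j) (Z (pos i)) (Z (pos j))))))
      (≤-trans (∣∣-* (fromℕ-nonneg m) (∣∣-+ ((x i + x i) - Z (pos i)) (- ((x j + x j) - Z (pos j))) (section-≈ pot i<N) (≤-trans (≤-reflexive (ℚ.∣-p∣≡∣p∣ ((x j + x j) - Z (pos j)))) (section-≈ pot j<N))))
        (≤-reflexive (ℚ.*-comm (fromℕ m) (fromℕ 4))))
      where
      lem : ∀ m xi xj Zi Zj → fromℕ 2 * m * (xi - xj) - m * (Zi - Zj) ≡ m * (((xi + xi) - Zi) + (- ((xj + xj) - Zj)))
      lem = solve-∀ ℚ-ring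

-- Distances

true∨ : ∀ {a b} → a ≡ true → a ∨ b ≡ true
true∨ refl = refl

∨true : ∀ a {b} → b ≡ true → a ∨ b ≡ true
∨true true  refl = refl
∨true false refl = refl

∨-elim : ∀ a {b} → a ∨ b ≡ true → a ≡ true ⊎ b ≡ true
∨-elim true  _  = inj₁ refl
∨-elim false eq = inj₂ eq

∧-elim : ∀ a b → a ∧ b ≡ true → a ≡ true × b ≡ true
∧-elim true true _ = refl , refl

any-intro : ∀ {A : Set} (p : A → Bool) {xs x} → x ∈ xs → p x ≡ true → any p xs ≡ true
any-intro p (here refl)               px = true∨ px
any-intro p {xs = y ∷ _} (there x∈xs) px = ∨true (p y) (any-intro p x∈xs px)

any-elim : ∀ {A : Set} (p : A → Bool) xs → any p xs ≡ true → ∃ λ x → x ∈ xs × p x ≡ true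
any-elim p (x ∷ xs) eq with ∨-elim (p x) eq
... | inj₁ px = x , here refl , px
... | inj₂ eq′ with any-elim p xs eq′
...   | y , y∈xs , py = y , there y∈xs , py

Step : List (ℕ × ℕ) → ℕ → ℕ → Set
Step es a b = (a , b) ∈ es ⊎ (b , a) ∈ es

adj-step : ∀ es i j → adj es i j ≡ true → Step es i j
adj-step es i j eq with any-elim (λ e → joins e i j) es eq
... | (a , b) , e∈es , p with joins-elim a b i j p
...   | inj₁ (refl , refl) = inj₁ e∈es
...   | inj₂ (refl , refl) = inj₂ e∈es

step-adj : ∀ es i j → Step es i j → adj es i j ≡ true
step-adj es i j (inj₁ e∈es) = any-intro (λ e → joins e i j) e∈es (true∨ (cong₂ _∧_ (≡ᵇ-refl i) (≡ᵇ-refl j)))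
step-adj es i j (inj₂ e∈es) = any-intro (λ e → joins e i j) e∈es
  (∨true ((j ≡ᵇ i) ∧ (i ≡ᵇ j)) (cong₂ _∧_ (≡ᵇ-refl j) (≡ᵇ-refl i)))

firstFrom-≥ : ∀ p c k f → (∀ d → p d ≡ true → c ℕ.≤ d) → c ℕ.≤ k ℕ.+ f → c ℕ.≤ firstFrom p k f
firstFrom-≥ p c k zero    p≥ c≤ = subst (c ℕ.≤_) (ℕ.+-identityʳ k) c≤
firstFrom-≥ p c k (suc f) p≥ c≤ with p k in eq
... | true  = p≥ k eq
... | false = firstFrom-≥ p c (suc k) f p≥ (subst (c ℕ.≤_) (ℕ.+-suc k f) c≤)

firstFrom-≤ : ∀ p d k f → p d ≡ true → k ℕ.≤ d → firstFrom p k f ℕ.≤ d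
-- With the fuel spent the search returns its current candidate, which has not passed `d`; so a
-- witness `d` beyond the search range is covered as well.
firstFrom-≤ p d k zero    pd k≤d = k≤d
firstFrom-≤ p d k (suc f) pd k≤d with p k in eq | ℕ.m≤n⇒m<n∨m≡n k≤d
... | true  | _         = k≤d
... | false | inj₁ k<d  = firstFrom-≤ p d (suc k) f pd k<d
... | false | inj₂ refl with trans (sym pd) eq
...   | ()

-- A function that vanishes at `i` and grows by at most one along each edge cannot exceed the number
-- of steps taken. The bound by `N` covers a failing search, for which `dist` returns `N`.
dist-≥ : ∀ {N} es (i j : Fin N) (f : ℕ → ℕ) → f (toℕ i) ≡ 0 → (∀ {a b} → Step es a b → f b ℕ.≤ suc (f a)) →
  f (toℕ j) ℕ.≤ N → f (toℕ j) ℕ.≤ dist (fromEdges es) i j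
dist-≥ {N} es i j f f≡0 f-step f≤N = firstFrom-≥ (λ k → reach (fromEdges es) k i j) (f (toℕ j)) 0 N (λ d → bound d j) f≤N
  where
  bound : ∀ k v → reach (fromEdges es) k i v ≡ true → f (toℕ v) ℕ.≤ k
  bound zero    v eq = ℕ.≤-reflexive (trans (cong f (sym (≡ᵇ-true (toℕ i) (toℕ v) eq))) f≡0)
  bound (suc k) v eq with ∨-elim (reach (fromEdges es) k i v) eq
  ... | inj₁ r = ℕ.m≤n⇒m≤1+n (bound k v r)
  ... | inj₂ r with any-elim (λ u → reach (fromEdges es) k i u ∧ fromEdges es u v) (allFin N) r
  ...   | u , _ , r′ with ∧-elim (reach (fromEdges es) k i u) (fromEdges es u v) r′
  ...     | r″ , e = ℕ.≤-trans (f-step (adj-step es (toℕ u) (toℕ v) e)) (s≤s (bound k u r″))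

-- The index is an upper bound on the length, not the length itself, which matches `reach`: that too
-- is cumulative in its number of steps.
data Walk (es : List (ℕ × ℕ)) : ℕ → ℕ → ℕ → Set where
  stay : ∀ {k a} → Walk es k a a
  _▷_  : ∀ {k a b c} → Walk es k a b → Step es b c → Walk es (suc k) a c

module _ {es : List (ℕ × ℕ)} where

  weaken : ∀ {k k′ a b} → k ℕ.≤ k′ → Walk es k a b → Walk es k′ a b
  weaken _          stay    = stay
  weaken (s≤s k≤k′) (p ▷ e) = weaken k≤k′ p ▷ e

  _▷▷_ : ∀ {k k′ a b c} → Walk es k a b → Walk es k′ b c → Walk es (k′ ℕ.+ k) a c
  _▷▷_ {k} {k′} p stay    = weaken (ℕ.m≤n+m k k′) p
  p ▷▷ (q ▷ e) = (p ▷▷ q) ▷ e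

  flip : ∀ {a b} → Step es a b → Step es b a
  flip (inj₁ e) = inj₂ e
  flip (inj₂ e) = inj₁ e

  reverse : ∀ {k a b} → Walk es k a b → Walk es k b a
  reverse stay = stay
  reverse {suc k} {a} {b} (p ▷ e) = subst (λ k → Walk es k b a) (ℕ.+-comm k 1) ((stay {k = 0} ▷ flip e) ▷▷ reverse p)

  walk-reach : ∀ {N} → All (IsEdge N) es → ∀ {k b} (i j : Fin N) → Walk es k (toℕ i) b → b ≡ toℕ j →
    reach (fromEdges es) k i j ≡ true
  walk-reach es✓ {zero}  i j stay eq = subst (λ b → (toℕ i ≡ᵇ b) ≡ true) eq (≡ᵇ-refl (toℕ i))
  walk-reach es✓ {suc k} i j stay eq = true∨ (walk-reach es✓ {k} i j stay eq)
  walk-reach {N} es✓ {suc k} i j (_▷_ {b = b} p e) refl =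
    ∨true (reach (fromEdges es) k i j) (any-intro (λ u → reach (fromEdges es) k i u ∧ fromEdges es u j) (∈-allFin v)
      (cong₂ _∧_ (walk-reach es✓ i v p (sym (Fin.toℕ-fromℕ< b<N)))
        (step-adj es (toℕ v) (toℕ j) (subst (λ b → Step es b (toℕ j)) (sym (Fin.toℕ-fromℕ< b<N)) e))))
    where
    start : ∀ {a b} → Step es a b → a ℕ.< N
    start (inj₁ e) = proj₁ (All.lookup es✓ e)
    start (inj₂ e) = proj₁ (proj₂ (All.lookup es✓ e))
    b<N : b ℕ.< N
    b<N = start e
    v : Fin N
    v = fromℕ< b<N

  dist-≤ : ∀ {N} → All (IsEdge N) es → ∀ {k} (i j : Fin N) → Walk es k (toℕ i) (toℕ j) → dist (fromEdges es) i j ℕ.≤ k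
  dist-≤ {N} es✓ {k} i j p = firstFrom-≤ (λ k → reach (fromEdges es) k i j) k 0 N (walk-reach es✓ i j p refl) z≤n

cyc : ℕ → ℕ → ℕ → ℕ
cyc m p q = ℕ.∣ p - q ∣ ℕ.⊓ (m ℕ.∸ ℕ.∣ p - q ∣)

cyc-comm : ∀ m p q → cyc m p q ≡ cyc m q p
cyc-comm m p q = cong (λ e → e ℕ.⊓ (m ℕ.∸ e)) (ℕ.∣-∣-comm p q)

-- Each arm of the minimum changes by at most one: the increasing arm uses `e ≤ suc d`, the
-- decreasing one `d ≤ suc e`.
min-∸-step : ∀ m d e → e ℕ.≤ suc d → d ℕ.≤ suc e → e ℕ.⊓ (m ℕ.∸ e) ℕ.≤ suc (d ℕ.⊓ (m ℕ.∸ d))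
min-∸-step m d e e≤ d≤ = ℕ.⊓-mono-≤ e≤ (ℕ.≤-trans (∸-suc m e) (s≤s (ℕ.∸-monoʳ-≤ m d≤)))
  where
  ∸-suc : ∀ m e → m ℕ.∸ e ℕ.≤ suc (m ℕ.∸ suc e)
  ∸-suc zero    zero    = z≤n
  ∸-suc zero    (suc e) = z≤n
  ∸-suc (suc m) zero    = ℕ.≤-refl
  ∸-suc (suc m) (suc e) = ∸-suc m e

∣-∣-step : ∀ p q q′ → ℕ.∣ q - q′ ∣ ≡ 1 → ℕ.∣ p - q ∣ ℕ.≤ suc ℕ.∣ p - q′ ∣
∣-∣-step p q q′ eq = ℕ.≤-trans (ℕ.∣-∣-triangle p q′ q)
  (ℕ.≤-reflexive (trans (cong (ℕ.∣ p - q′ ∣ ℕ.+_) (trans (ℕ.∣-∣-comm q′ q) eq)) (ℕ.+-comm _ 1)))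

cyc-step : ∀ m p q q′ → ℕ.∣ q - q′ ∣ ≡ 1 → cyc m p q ℕ.≤ suc (cyc m p q′)
cyc-step m p q q′ eq = min-∸-step m ℕ.∣ p - q′ ∣ ℕ.∣ p - q ∣ (∣-∣-step p q q′ eq) (∣-∣-step p q′ q (trans (ℕ.∣-∣-comm q′ q) eq))

module ChainDistance (tw : Bool) (n l : ℕ) (2n≡m : 2 ℕ.* n ≡ suc l) (2≤l : 2 ℕ.≤ l) where

  open Chain tw n l 2n≡m 2≤l

  -- The cases are a rung, a rail edge and a wrap, oriented as the edges are listed.
  Near : ℕ → ℕ → Set
  Near p q = p ≡ q ⊎ q ≡ suc p ⊎ (p ≡ l × q ≡ 0)

  edges-near : All (λ (a , b) → Near (pos a) (pos b)) edges
  edges-near = wrap₁ tw ∷ wrap₂ tw ∷ All-commons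
    (λ i<l → inj₂ (inj₁ (trans (pos-u (s≤s i<l)) (cong suc (sym (pos-u (ℕ.m<n⇒m<1+n i<l)))))))
    (λ i<l → inj₂ (inj₁ (trans (pos-u′ (s≤s i<l)) (cong suc (sym (pos-u′ (ℕ.m<n⇒m<1+n i<l)))))))
    (λ k<n → inj₁ (trans (pos-u (even< k<n)) (sym (pos-u′ (even< k<n)))))
    (λ {k} k<n → inj₁ (trans (pos-u (odd< k<n)) (sym (pos-w k))))
    (λ {k} k<n → inj₁ (trans (pos-w k) (sym (pos-u′ (odd< k<n)))))
    where
    wrap₁ : ∀ tw → Near (pos l) (pos (if tw then m else 0))
    wrap₁ true  = inj₂ (inj₂ (pos-u l<m , pos-m))
    wrap₁ false = inj₂ (inj₂ (pos-u l<m , pos-u (s≤s z≤n)))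
    wrap₂ : ∀ tw → Near (pos (m ℕ.+ l)) (pos (if tw then 0 else m))
    wrap₂ true  = inj₂ (inj₂ (pos-u′ l<m , pos-u (s≤s z≤n)))
    wrap₂ false = inj₂ (inj₂ (pos-u′ l<m , pos-m))

  module _ {p : ℕ} (p≤l : p ℕ.≤ l) where

    cyc-0 : cyc m p 0 ≡ p ℕ.⊓ suc (l ℕ.∸ p)
    cyc-0 rewrite ℕ.∣-∣-identityʳ p = cong (p ℕ.⊓_) (ℕ.+-∸-assoc 1 p≤l)

    cyc-l : cyc m p l ≡ (l ℕ.∸ p) ℕ.⊓ suc p
    cyc-l rewrite ℕ.m≤n⇒∣m-n∣≡n∸m p≤l = cong ((l ℕ.∸ p) ℕ.⊓_)
      (trans (ℕ.+-∸-assoc 1 (ℕ.m∸n≤m l p)) (cong suc (ℕ.m∸[m∸n]≡n p≤l)))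

    min-swap : ∀ a b → a ℕ.⊓ suc b ℕ.≤ suc (b ℕ.⊓ suc a)
    min-swap a b = ℕ.≤-trans (ℕ.≤-reflexive (ℕ.⊓-comm a (suc b))) (ℕ.⊓-mono-≤ (ℕ.≤-refl {suc b}) (ℕ.m≤n⇒m≤1+n (ℕ.n≤1+n a)))

    cyc-near : ∀ {q r} → Near q r → cyc m p q ℕ.≤ suc (cyc m p r) × cyc m p r ℕ.≤ suc (cyc m p q)
    cyc-near (inj₁ refl) = ℕ.n≤1+n _ , ℕ.n≤1+n _
    cyc-near {q} (inj₂ (inj₁ refl)) = cyc-step m p q (suc q) (length-rail₁ q)
      , cyc-step m p (suc q) q (trans (ℕ.∣-∣-comm (suc q) q) (length-rail₁ q))
    cyc-near (inj₂ (inj₂ (refl , refl))) = subst₂ ℕ._≤_ (sym cyc-l) (cong suc (sym cyc-0)) (min-swap (l ℕ.∸ p) p)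
      , subst₂ ℕ._≤_ (sym cyc-0) (cong suc (sym cyc-l)) (min-swap p (l ℕ.∸ p))

    cyc-edge : ∀ {a b} → Step edges a b → cyc m p (pos b) ℕ.≤ suc (cyc m p (pos a))
    cyc-edge (inj₁ e) = proj₂ (cyc-near (All.lookup edges-near e))
    cyc-edge (inj₂ e) = proj₁ (cyc-near (All.lookup edges-near e))

  cyc≤dist : ∀ (i j : Fin N) → cyc m (pos (toℕ i)) (pos (toℕ j)) ℕ.≤ dist (fromEdges edges) i j
  cyc≤dist i j = dist-≥ edges i j (λ v → cyc m (pos (toℕ i)) (pos v))
    (cong (λ e → e ℕ.⊓ (m ℕ.∸ e)) (ℕ.∣n-n∣≡0 (pos (toℕ i))))
    (cyc-edge (ℕ.≤-pred (pos<m (Fin.toℕ<n i))))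
    -- The bound required for a failing search: a cyclic distance is at most `m`, hence at most the
    -- number of vertices.
    (ℕ.≤-trans (ℕ.m⊓n≤n ℕ.∣ pos (toℕ i) - pos (toℕ j) ∣ _) (ℕ.≤-trans (ℕ.m∸n≤m m ℕ.∣ pos (toℕ i) - pos (toℕ j) ∣) (ℕ.≤-trans (ℕ.m≤m+n m m) (ℕ.m≤m+n (m ℕ.+ m) n))))

  -- A centre for each position: the vertex on the first rail if the position is even, the vertex
  -- `w` if it is odd. All vertices of the position are at most one step away, so changing vertex
  -- costs at most two steps; doing so at both ends of a journey gives the 4 in `travel`.
  hub : ∀ {p} → Parity p → ℕ
  hub (even {k} _) = 2 ℕ.* k
  hub (odd {k} _)  = m ℕ.+ m ℕ.+ k

  to-hub : ∀ {v p} → Vertex v → (P : Parity p) → pos v ≡ p → Walk edges 1 v (hub P)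
  to-hub (u p<m) P eq with trans (sym (pos-u p<m)) eq | P
  ... | refl | even _   = stay
  ... | refl | odd k<n  = stay ▷ inj₁ (rung₂∈ k<n)
  to-hub (u′ p<m) P eq with trans (sym (pos-u′ p<m)) eq | P
  ... | refl | even k<n = stay ▷ inj₂ (rung₁∈ k<n)
  ... | refl | odd k<n  = stay ▷ inj₂ (rung₃∈ k<n)
  to-hub (w {k} _) P eq with trans (sym (pos-w k)) eq
  to-hub (w {k} _) (even {k′} _) eq | eq′ = ⊥-elim (ℕ.even≢odd k′ k (sym eq′))
  to-hub (w {k} _) (odd {k′} _)  eq | eq′ = subst (λ k′ → Walk edges 1 (m ℕ.+ m ℕ.+ k) (m ℕ.+ m ℕ.+ k′))
    (ℕ.*-cancelˡ-≡ k k′ 2 (ℕ.suc-injective eq′)) stay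

  meet : ∀ {a b} → a ℕ.< N → b ℕ.< N → pos a ≡ pos b → Walk edges 2 a b
  meet a<N b<N eq = to-hub (vertex a<N) P eq ▷▷ reverse (to-hub (vertex b<N) P refl)
    where P = parity (pos<m b<N)

  along₁ : ∀ p d → p ℕ.+ d ℕ.≤ l → Walk edges d p (p ℕ.+ d)
  along₁ p zero    _  = subst (Walk edges 0 p) (sym (ℕ.+-identityʳ p)) stay
  along₁ p (suc d) ≤l = subst (Walk edges (suc d) p) (sym (ℕ.+-suc p d)) (along₁ p d (ℕ.<⇒≤ <l) ▷ inj₁ (rail₁∈ <l))
    where
    <l : p ℕ.+ d ℕ.< l
    <l = subst (ℕ._≤ l) (ℕ.+-suc p d) ≤l

  along₂ : ∀ p d → p ℕ.+ d ℕ.≤ l → Walk edges d (m ℕ.+ p) (m ℕ.+ (p ℕ.+ d))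
  along₂ p zero    _  = subst (λ q → Walk edges 0 (m ℕ.+ p) (m ℕ.+ q)) (sym (ℕ.+-identityʳ p)) stay
  along₂ p (suc d) ≤l = subst (λ q → Walk edges (suc d) (m ℕ.+ p) (m ℕ.+ q)) (sym (ℕ.+-suc p d)) (along₂ p d (ℕ.<⇒≤ <l) ▷ inj₁ (rail₂∈ <l))
    where
    <l : p ℕ.+ d ℕ.< l
    <l = subst (ℕ._≤ l) (ℕ.+-suc p d) ≤l

  -- Backwards from `p` to 0, over the wrap, and backwards from `l` to `q`. In the Möbius chain the
  -- wrap leads to the other rail, so only the position of the end vertex is claimed; `meet`
  -- corrects the rail afterwards.
  around : ∀ {p q} → p ℕ.≤ q → q ℕ.≤ l → ∃ λ a → a ℕ.< N × pos a ≡ q × Walk edges ((l ℕ.∸ q) ℕ.+ suc p) p a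
  around {p} {q} p≤q q≤l = go tw refl
    where
    l-eq : q ℕ.+ (l ℕ.∸ q) ≡ l
    l-eq = ℕ.m+[n∸m]≡n q≤l
    back : Walk edges p p 0
    back = reverse (along₁ 0 p (ℕ.≤-trans p≤q q≤l))
    go : ∀ b → tw ≡ b → ∃ λ a → a ℕ.< N × pos a ≡ q × Walk edges ((l ℕ.∸ q) ℕ.+ suc p) p a
    go false eq = q , u<N (s≤s q≤l) , pos-u (s≤s q≤l) ,
      ((back ▷ inj₂ (here (cong (λ b → l , (if b then m else 0)) (sym eq)))) ▷▷
        reverse (subst (Walk edges (l ℕ.∸ q) q) l-eq (along₁ q (l ℕ.∸ q) (ℕ.≤-reflexive l-eq))))
    go true  eq = m ℕ.+ q , u′<N (s≤s q≤l) , pos-u′ (s≤s q≤l) ,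
      ((back ▷ inj₂ (there (here (cong (λ b → m ℕ.+ l , (if b then 0 else m)) (sym eq))))) ▷▷
        reverse (subst (λ r → Walk edges (l ℕ.∸ q) (m ℕ.+ q) (m ℕ.+ r)) l-eq (along₂ q (l ℕ.∸ q) (ℕ.≤-reflexive l-eq))))

  arc : ∀ {p q} → p ℕ.≤ q → q ℕ.≤ l → ∃ λ a → a ℕ.< N × pos a ≡ q × Walk edges (cyc m p q) p a
  arc {p} {q} p≤q q≤l with ℕ.≤-total ℕ.∣ p - q ∣ (m ℕ.∸ ℕ.∣ p - q ∣)
  ... | inj₁ e≤ = q , u<N (s≤s q≤l) , pos-u (s≤s q≤l) , subst (λ d → Walk edges d p q)
      (trans (sym (ℕ.m≤n⇒∣m-n∣≡n∸m p≤q)) (sym (ℕ.m≤n⇒m⊓n≡m e≤)))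
      (subst (Walk edges (q ℕ.∸ p) p) eq (along₁ p (q ℕ.∸ p) (subst (ℕ._≤ l) (sym eq) q≤l)))
    where
    eq : p ℕ.+ (q ℕ.∸ p) ≡ q
    eq = ℕ.m+[n∸m]≡n p≤q
  ... | inj₂ ≤e with around p≤q q≤l
  ...   | a , a<N , pos-a , walk = a , a<N , pos-a , subst (λ d → Walk edges d p a)
      (trans len (sym (ℕ.m≥n⇒m⊓n≡n ≤e))) walk
    where
    len : (l ℕ.∸ q) ℕ.+ suc p ≡ m ℕ.∸ ℕ.∣ p - q ∣
    len = sym (begin
      m ℕ.∸ ℕ.∣ p - q ∣
        ≡⟨ cong (m ℕ.∸_) (ℕ.m≤n⇒∣m-n∣≡n∸m p≤q) ⟩
      m ℕ.∸ (q ℕ.∸ p)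
        ≡⟨ cong (ℕ._∸ (q ℕ.∸ p)) split ⟩
      (l ℕ.∸ q) ℕ.+ suc p ℕ.+ (q ℕ.∸ p) ℕ.∸ (q ℕ.∸ p)
        ≡⟨ ℕ.m+n∸n≡m ((l ℕ.∸ q) ℕ.+ suc p) (q ℕ.∸ p) ⟩
      (l ℕ.∸ q) ℕ.+ suc p ∎)
      where
      open ≡-Reasoning
      split : m ≡ (l ℕ.∸ q) ℕ.+ suc p ℕ.+ (q ℕ.∸ p)
      split = sym (begin
        (l ℕ.∸ q) ℕ.+ suc p ℕ.+ (q ℕ.∸ p)    ≡⟨ ℕ.+-assoc (l ℕ.∸ q) (suc p) (q ℕ.∸ p) ⟩
        (l ℕ.∸ q) ℕ.+ suc (p ℕ.+ (q ℕ.∸ p))  ≡⟨ cong (λ r → (l ℕ.∸ q) ℕ.+ suc r) (ℕ.m+[n∸m]≡n p≤q) ⟩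
        (l ℕ.∸ q) ℕ.+ suc q                  ≡⟨ ℕ.+-suc (l ℕ.∸ q) q ⟩
        suc ((l ℕ.∸ q) ℕ.+ q)                ≡⟨ cong suc (ℕ.m∸n+n≡m q≤l) ⟩
        m ∎)

  travel : ∀ {a b} → a ℕ.< N → b ℕ.< N → pos a ℕ.≤ pos b → Walk edges (4 ℕ.+ cyc m (pos a) (pos b)) a b
  travel {a} {b} a<N b<N a≤b with arc a≤b (ℕ.≤-pred (pos<m b<N))
  ... | c , c<N , pos-c , walk = subst (λ d → Walk edges d a b) (cong (2 ℕ.+_) (ℕ.+-comm (cyc m (pos a) (pos b)) 2))
    ((meet a<N (u<N (pos<m a<N)) (sym (pos-u (pos<m a<N))) ▷▷ walk) ▷▷ meet c<N b<N pos-c)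

  dist≤cyc+4 : ∀ (i j : Fin N) → dist (fromEdges edges) i j ℕ.≤ 4 ℕ.+ cyc m (pos (toℕ i)) (pos (toℕ j))
  dist≤cyc+4 i j with ℕ.≤-total (pos (toℕ i)) (pos (toℕ j))
  ... | inj₁ i≤j = dist-≤ edges✓ i j (travel (Fin.toℕ<n i) (Fin.toℕ<n j) i≤j)
  ... | inj₂ j≤i = dist-≤ edges✓ i j (subst (λ d → Walk edges (4 ℕ.+ d) (toℕ i) (toℕ j)) (cyc-comm m (pos (toℕ j)) (pos (toℕ i)))
      (reverse (travel (Fin.toℕ<n j) (Fin.toℕ<n i) j≤i)))

-- Estimates

≤⇒0≤ : ∀ {a b} → a ≤ b → 0ℚ ≤ b - a
≤⇒0≤ {a} {b} a≤b = ≤-shift a≤b (lem a b)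
  where
  lem : ∀ a b → (b - a) - 0ℚ ≡ b - a
  lem = solve-∀ ℚ-ring

fromℕ-diff-≤ : ∀ a b k → a ℕ.≤ k ℕ.+ b → fromℕ a - fromℕ b ≤ fromℕ k
fromℕ-diff-≤ a b k a≤ = ≤-shift (fromℕ-mono {a} {k ℕ.+ b} a≤) (trans (lem (fromℕ a) (fromℕ b) (fromℕ k)) (cong (_- fromℕ a) (sym (fromℕ-+ k b))))
  where
  lem : ∀ a b k → k - (a - b) ≡ (k + b) - a
  lem = solve-∀ ℚ-ring

fromℕ-∣diff∣-≤ : ∀ a b k → a ℕ.≤ k ℕ.+ b → b ℕ.≤ k ℕ.+ a → ∣ fromℕ a - fromℕ b ∣ ≤ fromℕ k
fromℕ-∣diff∣-≤ a b k a≤ b≤ = ∣∣-intro (fromℕ-diff-≤ a b k a≤) (≤-trans (≤-reflexive (lem (fromℕ a) (fromℕ b))) (fromℕ-diff-≤ b a k b≤))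
  where
  lem : ∀ a b → - (a - b) ≡ b - a
  lem = solve-∀ ℚ-ring

fromℕ-∸ : ∀ {a b} → a ℕ.≤ b → fromℕ (b ℕ.∸ a) ≡ fromℕ b - fromℕ a
fromℕ-∸ {a} {b} a≤b = trans (lem (fromℕ (b ℕ.∸ a)) (fromℕ a))
  (cong (_- fromℕ a) (trans (sym (fromℕ-+ (b ℕ.∸ a) a)) (cong fromℕ (ℕ.m∸n+n≡m a≤b))))
  where
  lem : ∀ c a → c ≡ (c + a) - a
  lem = solve-∀ ℚ-ring

-- Moving the centre from `suc q` down to `q` replaces the term `h (suc q)` by the term at gap l -
-- q. The two arguments add up to the period `suc l`, so the symmetry of `h` makes the terms equal.
∑<-rotate : ∀ l (h : ℕ → ℚ) → (∀ e → e ℕ.≤ suc l → h (suc l ℕ.∸ e) ≡ h e) → ∀ q → q ℕ.≤ l →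
  ∑< (suc l) (λ p → h ℕ.∣ p - q ∣) ≡ ∑< (suc l) h
∑<-rotate l h h-sym zero    _   = ∑<-cong (suc l) (λ p _ → cong h (ℕ.∣-∣-identityʳ p))
∑<-rotate l h h-sym (suc q) q<l = begin
  ∑< (suc l) (λ p → h ℕ.∣ p - suc q ∣)            ≡⟨ ∑<-suc l (λ p → h ℕ.∣ p - suc q ∣) ⟩
  h (suc q) + ∑< l (λ p → h ℕ.∣ p - q ∣)          ≡⟨ ℚ.+-comm (h (suc q)) _ ⟩
  ∑< l (λ p → h ℕ.∣ p - q ∣) + h (suc q)          ≡⟨ cong (∑< l (λ p → h ℕ.∣ p - q ∣) +_) last ⟩
  ∑< l (λ p → h ℕ.∣ p - q ∣) + h ℕ.∣ l - q ∣      ≡⟨ ∑<-last l (λ p → h ℕ.∣ p - q ∣) ⟨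
  ∑< (suc l) (λ p → h ℕ.∣ p - q ∣)                ≡⟨ ∑<-rotate l h h-sym q (ℕ.<⇒≤ q<l) ⟩
  ∑< (suc l) h                                    ∎
  where
  open ≡-Reasoning
  last : h (suc q) ≡ h ℕ.∣ l - q ∣
  last = trans (sym (h-sym (suc q) (s≤s (ℕ.<⇒≤ q<l))))
    (cong h (sym (trans (ℕ.∣-∣-comm l q) (ℕ.m≤n⇒∣m-n∣≡n∸m (ℕ.<⇒≤ q<l)))))

∣-∣-suc : ∀ p q → ℕ.∣ suc p - q ∣ ≡ suc ℕ.∣ p - q ∣ ⊎ ℕ.∣ p - q ∣ ≡ suc ℕ.∣ suc p - q ∣
∣-∣-suc p       zero    = inj₁ (cong suc (sym (ℕ.∣-∣-identityʳ p)))
∣-∣-suc zero    (suc q) = inj₂ refl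
∣-∣-suc (suc p) (suc q) = ∣-∣-suc p q

-- The terms on the right are six times the sums of μ e and of e². Keeping `μ` independent of the
-- upper limit lets the induction on `k` go through; both are set to the period in `∑H`.
∑<-parabola : ∀ μ k → fromℕ 6 * ∑< k (λ e → fromℕ e * (μ - fromℕ e)) ≡
  fromℕ 3 * μ * fromℕ k * (fromℕ k - 1ℚ) - (fromℕ k - 1ℚ) * fromℕ k * (fromℕ 2 * fromℕ k - 1ℚ)
∑<-parabola μ zero    = lem μ
  where
  lem : ∀ μ → fromℕ 6 * 0ℚ ≡ fromℕ 3 * μ * 0ℚ * (0ℚ - 1ℚ) - (0ℚ - 1ℚ) * 0ℚ * (fromℕ 2 * 0ℚ - 1ℚ)
  lem = solve-∀ ℚ-ring
∑<-parabola μ (suc k) = trans (cong (fromℕ 6 *_) (∑<-last k (λ e → fromℕ e * (μ - fromℕ e))))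
  (trans (ℚ.*-distribˡ-+ (fromℕ 6) (∑< k (λ e → fromℕ e * (μ - fromℕ e))) _)
  (trans (cong (_+ fromℕ 6 * (fromℕ k * (μ - fromℕ k))) (∑<-parabola μ k))
  (trans (lem μ (fromℕ k))
    (cong (λ κ → fromℕ 3 * μ * κ * (κ - 1ℚ) - (κ - 1ℚ) * κ * (fromℕ 2 * κ - 1ℚ)) (sym (fromℕ-suc k))))))
  where
  lem : ∀ μ k → (fromℕ 3 * μ * k * (k - 1ℚ) - (k - 1ℚ) * k * (fromℕ 2 * k - 1ℚ)) + fromℕ 6 * (k * (μ - k))
    ≡ fromℕ 3 * μ * (1ℚ + k) * ((1ℚ + k) - 1ℚ) - ((1ℚ + k) - 1ℚ) * (1ℚ + k) * (fromℕ 2 * (1ℚ + k) - 1ℚ)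
  lem = solve-∀ ℚ-ring

-- The two halves pair up: for i < n the summands at i and n + i are i and n - i.
∑<-tent : ∀ n → ∑< (2 ℕ.* n) (λ e → fromℕ (e ℕ.⊓ (2 ℕ.* n ℕ.∸ e))) ≡ fromℕ n * fromℕ n
∑<-tent n = begin
  ∑< (2 ℕ.* n) c                                        ≡⟨ cong (λ m → ∑< m c) 2n≡n+n ⟩
  ∑< (n ℕ.+ n) c                                        ≡⟨ ∑<-+ n n c ⟩
  ∑< n c + ∑< n (λ i → c (n ℕ.+ i))                     ≡⟨ ∑-+ (upTo n) c (λ i → c (n ℕ.+ i)) ⟨
  ∑< n (λ i → c i + c (n ℕ.+ i))                        ≡⟨ ∑<-cong n pair ⟩
  ∑< n (λ _ → fromℕ n)                                  ≡⟨ ∑<-const n (fromℕ n) ⟩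
  fromℕ n * fromℕ n                                     ∎
  where
  open ≡-Reasoning
  c : ℕ → ℚ
  c e = fromℕ (e ℕ.⊓ (2 ℕ.* n ℕ.∸ e))
  2n≡n+n : 2 ℕ.* n ≡ n ℕ.+ n
  2n≡n+n = cong (n ℕ.+_) (ℕ.+-identityʳ n)
  pair : ∀ i → i ℕ.< n → c i + c (n ℕ.+ i) ≡ fromℕ n
  pair i i<n = trans (sym (fromℕ-+ (i ℕ.⊓ (2 ℕ.* n ℕ.∸ i)) _)) (cong fromℕ (trans (cong₂ ℕ._+_ left right) (ℕ.m+[n∸m]≡n (ℕ.<⇒≤ i<n))))
    where
    i≤n : i ℕ.≤ n
    i≤n = ℕ.<⇒≤ i<n
    left : i ℕ.⊓ (2 ℕ.* n ℕ.∸ i) ≡ i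
    left = ℕ.m≤n⇒m⊓n≡m (ℕ.≤-trans i≤n (subst (n ℕ.≤_) (sym (trans (cong (ℕ._∸ i) 2n≡n+n) (ℕ.+-∸-assoc n i≤n))) (ℕ.m≤m+n n (n ℕ.∸ i))))
    right : (n ℕ.+ i) ℕ.⊓ (2 ℕ.* n ℕ.∸ (n ℕ.+ i)) ≡ n ℕ.∸ i
    right rewrite 2n≡n+n | ℕ.[m+n]∸[m+o]≡n∸o n n i =
      ℕ.m≥n⇒m⊓n≡n (ℕ.≤-trans (ℕ.m∸n≤m n i) (ℕ.m≤m+n n i))

⟦⟧-nonneg : ∀ b → 0ℚ ≤ ⟦ b ⟧
⟦⟧-nonneg true  = fromℕ-mono {0} {1} z≤n
⟦⟧-nonneg false = ≤-refl

module ChainRows (tw : Bool) (n l : ℕ) (2n≡m : 2 ℕ.* n ≡ suc l) (2≤l : 2 ℕ.≤ l) where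

  open Chain tw n l 2n≡m 2≤l
  open ChainResistance tw n l 2n≡m 2≤l

  μ ν : ℚ
  μ = fromℕ m
  ν = fromℕ n

  μ≡2ν : μ ≡ fromℕ 2 * ν
  μ≡2ν = trans (cong fromℕ (sym 2n≡m)) (fromℕ-* 2 n)

  0≤ν : 0ℚ ≤ ν
  0≤ν = fromℕ-nonneg n

  0≤μ : 0ℚ ≤ μ
  0≤μ = fromℕ-nonneg m

  c ρ H : ℕ → ℚ
  c e = fromℕ (e ℕ.⊓ (m ℕ.∸ e))
  ρ e = fromℕ e * (μ - fromℕ e)
  H e = fromℕ 2 * μ * c e - fromℕ 3 * ρ e

  c-sym : ∀ e → e ℕ.≤ m → c (m ℕ.∸ e) ≡ c e
  c-sym e e≤m = cong fromℕ (trans (cong ((m ℕ.∸ e) ℕ.⊓_) (ℕ.m∸[m∸n]≡n e≤m)) (ℕ.⊓-comm (m ℕ.∸ e) e))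

  ρ-sym : ∀ e → e ℕ.≤ m → ρ (m ℕ.∸ e) ≡ ρ e
  ρ-sym e e≤m = trans (cong (λ d → d * (μ - d)) (fromℕ-∸ e≤m)) (lem μ (fromℕ e))
    where
    lem : ∀ μ e → (μ - e) * (μ - (μ - e)) ≡ e * (μ - e)
    lem = solve-∀ ℚ-ring

  H-sym : ∀ e → e ℕ.≤ m → H (m ℕ.∸ e) ≡ H e
  H-sym e e≤m = cong₂ (λ p q → fromℕ 2 * μ * p - fromℕ 3 * q) (c-sym e e≤m) (ρ-sym e e≤m)

  c-Lipschitz : ∀ e → suc e ℕ.≤ m → ∣ c (suc e) - c e ∣ ≤ 1ℚ
  c-Lipschitz e _ = fromℕ-∣diff∣-≤ (suc e ℕ.⊓ (m ℕ.∸ suc e)) (e ℕ.⊓ (m ℕ.∸ e)) 1 (min-∸-step m e (suc e) ℕ.≤-refl (ℕ.m≤n⇒m≤1+n (ℕ.n≤1+n e)))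
    (min-∸-step m (suc e) e (ℕ.m≤n⇒m≤1+n (ℕ.n≤1+n e)) ℕ.≤-refl)

  -- The increment is μ - (2 e + 1), and 0 ≤ e < m places it between -μ and μ.
  ρ-Lipschitz : ∀ e → suc e ℕ.≤ m → ∣ ρ (suc e) - ρ e ∣ ≤ μ
  ρ-Lipschitz e e<m = ≤-trans (≤-reflexive (cong ∣_∣ (trans (cong (λ d → d * (μ - d) - ρ e) (fromℕ-suc e)) (lem μ (fromℕ e)))))
    (∣∣-intro (≤-shift (+-nonneg (fromℕ-nonneg (suc e)) (fromℕ-nonneg e)) (lem₁ μ (fromℕ e) (fromℕ-suc e)))
      (≤-shift (+-nonneg (≤⇒0≤ (fromℕ-mono {suc e} {m} e<m)) (≤⇒0≤ (fromℕ-mono {e} {m} (ℕ.<⇒≤ e<m)))) (lem₂ μ (fromℕ e) (fromℕ-suc e))))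
    where
    lem : ∀ μ e → (1ℚ + e) * (μ - (1ℚ + e)) - e * (μ - e) ≡ μ - ((1ℚ + e) + e)
    lem = solve-∀ ℚ-ring
    lem₁ : ∀ μ e {s} → s ≡ 1ℚ + e → μ - (μ - ((1ℚ + e) + e)) ≡ (s + e) - 0ℚ
    lem₁ μ e refl = lem′ μ e
      where
      lem′ : ∀ μ e → μ - (μ - ((1ℚ + e) + e)) ≡ ((1ℚ + e) + e) - 0ℚ
      lem′ = solve-∀ ℚ-ring
    lem₂ : ∀ μ e {s} → s ≡ 1ℚ + e → μ - (- (μ - ((1ℚ + e) + e))) ≡ ((μ - s) + (μ - e)) - 0ℚ
    lem₂ μ e refl = lem′ μ e
      where
      lem′ : ∀ μ e → μ - (- (μ - ((1ℚ + e) + e))) ≡ ((μ - (1ℚ + e)) + (μ - e)) - 0ℚ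
      lem′ = solve-∀ ℚ-ring

  H-Lipschitz : ∀ e → suc e ℕ.≤ m → ∣ H (suc e) - H e ∣ ≤ fromℕ 5 * μ
  H-Lipschitz e e<m = ≤-trans (≤-reflexive (cong ∣_∣ (lem μ (c (suc e)) (c e) (ρ (suc e)) (ρ e))))
    (≤-trans (∣∣-+ (fromℕ 2 * μ * (c (suc e) - c e)) (- (fromℕ 3 * (ρ (suc e) - ρ e)))
      (∣∣-* (*-nonneg (fromℕ-nonneg 2) 0≤μ) (c-Lipschitz e e<m))
      (≤-trans (≤-reflexive (ℚ.∣-p∣≡∣p∣ (fromℕ 3 * (ρ (suc e) - ρ e)))) (∣∣-* (fromℕ-nonneg 3) (ρ-Lipschitz e e<m))))
      (≤-reflexive (lem′ μ)))
    where
    lem : ∀ μ c′ c ρ′ ρ → (fromℕ 2 * μ * c′ - fromℕ 3 * ρ′) - (fromℕ 2 * μ * c - fromℕ 3 * ρ)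
      ≡ fromℕ 2 * μ * (c′ - c) + (- (fromℕ 3 * (ρ′ - ρ)))
    lem = solve-∀ ℚ-ring
    lem′ : ∀ μ → fromℕ 2 * μ * 1ℚ + fromℕ 3 * μ ≡ fromℕ 5 * μ
    lem′ = solve-∀ ℚ-ring

  ∑c : ∑< m c ≡ ν * ν
  ∑c = trans (cong (λ m → ∑< m (λ e → fromℕ (e ℕ.⊓ (m ℕ.∸ e)))) (sym 2n≡m)) (∑<-tent n)

  -- The leading terms cancel: this is where the limit 3 comes from.
  ∑H : ∑< m H ≡ ν
  ∑H = begin
    ∑< m H
      ≡⟨ ∑-- (upTo m) (λ e → fromℕ 2 * μ * c e) (λ e → fromℕ 3 * ρ e) ⟩
    ∑< m (λ e → fromℕ 2 * μ * c e) - ∑< m (λ e → fromℕ 3 * ρ e)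
      ≡⟨ cong₂ _-_ (trans (∑-*ˡ (upTo m) (fromℕ 2 * μ) c) (cong (fromℕ 2 * μ *_) ∑c)) (∑-*ˡ (upTo m) (fromℕ 3) ρ) ⟩
    fromℕ 2 * μ * (ν * ν) - fromℕ 3 * ∑< m ρ
      ≡⟨ lem₁ μ ν (∑< m ρ) ⟩
    fromℕ 2 * μ * (ν * ν) - ½ * (fromℕ 6 * ∑< m ρ)
      ≡⟨ cong (λ p → fromℕ 2 * μ * (ν * ν) - ½ * p) (∑<-parabola μ m) ⟩
    fromℕ 2 * μ * (ν * ν) - ½ * (fromℕ 3 * μ * μ * (μ - 1ℚ) - (μ - 1ℚ) * μ * (fromℕ 2 * μ - 1ℚ))
      ≡⟨ cong (λ μ → fromℕ 2 * μ * (ν * ν) - ½ * (fromℕ 3 * μ * μ * (μ - 1ℚ) - (μ - 1ℚ) * μ * (fromℕ 2 * μ - 1ℚ))) μ≡2ν ⟩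
    fromℕ 2 * (fromℕ 2 * ν) * (ν * ν) - ½ * (fromℕ 3 * (fromℕ 2 * ν) * (fromℕ 2 * ν) * ((fromℕ 2 * ν) - 1ℚ)
      - ((fromℕ 2 * ν) - 1ℚ) * (fromℕ 2 * ν) * (fromℕ 2 * (fromℕ 2 * ν) - 1ℚ))
      ≡⟨ lem₂ ν ⟩
    ν ∎
    where
    open ≡-Reasoning
    lem₁ : ∀ μ ν s → fromℕ 2 * μ * (ν * ν) - fromℕ 3 * s ≡ fromℕ 2 * μ * (ν * ν) - ½ * (fromℕ 6 * s)
    lem₁ = solve-∀ ℚ-ring
    lem₂ : ∀ ν → fromℕ 2 * (fromℕ 2 * ν) * (ν * ν) - ½ * (fromℕ 3 * (fromℕ 2 * ν) * (fromℕ 2 * ν) * ((fromℕ 2 * ν) - 1ℚ)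
      - ((fromℕ 2 * ν) - 1ℚ) * (fromℕ 2 * ν) * (fromℕ 2 * (fromℕ 2 * ν) - 1ℚ)) ≡ ν
    lem₂ = solve-∀ ℚ-ring

  row : (ℕ → ℚ) → ℕ → ℚ
  row h q = ∑< N (λ v → degree N edges v * h ℕ.∣ pos v - q ∣)

  -- With `E` and `O` the sums over even and odd positions, the row is 6 E + 8 O while E + O is the
  -- full period sum, independent of `q`. The difference from 7 (E + O) is O - E, which consists of
  -- `n` differences between neighbouring positions, each at most `L` in absolute value.
  row-≈ : ∀ h L → (∀ e → e ℕ.≤ m → h (m ℕ.∸ e) ≡ h e) → (∀ e → suc e ℕ.≤ m → ∣ h (suc e) - h e ∣ ≤ L) →
    ∀ {q} → q ℕ.< m → ∣ row h q - fromℕ 7 * ∑< m h ∣ ≤ ν * L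
  row-≈ h L h-sym h-Lip {q} q<m = subst₂ _≤_ (cong ∣_∣ (sym eq)) (∑<-const n L) (∑<-∣∣ n step-≤)
    where
    h′ : ℕ → ℚ
    h′ p = h ℕ.∣ p - q ∣
    E = ∑< n (λ k → h′ (2 ℕ.* k))
    O = ∑< n (λ k → h′ (suc (2 ℕ.* k)))
    eq : row h q - fromℕ 7 * ∑< m h ≡ ∑< n (λ k → h′ (suc (2 ℕ.* k)) - h′ (2 ℕ.* k))
    eq = begin
      row h q - fromℕ 7 * ∑< m h
        ≡⟨ cong₂ _-_ (∑-degree-pos h′) (cong (fromℕ 7 *_) (trans (sym (∑<-rotate l h h-sym q (ℕ.≤-pred q<m))) (∑<-parity h′))) ⟩
      (fromℕ 6 * E + fromℕ 8 * O) - fromℕ 7 * (E + O)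
        ≡⟨ lem E O ⟩
      O - E
        ≡⟨ ∑-- (upTo n) (λ k → h′ (suc (2 ℕ.* k))) (λ k → h′ (2 ℕ.* k)) ⟨
      ∑< n (λ k → h′ (suc (2 ℕ.* k)) - h′ (2 ℕ.* k)) ∎
      where
      open ≡-Reasoning
      lem : ∀ E O → (fromℕ 6 * E + fromℕ 8 * O) - fromℕ 7 * (E + O) ≡ O - E
      lem = solve-∀ ℚ-ring
    dist<m : ∀ {p} → p ℕ.< m → ℕ.∣ p - q ∣ ℕ.< m
    dist<m {p} p<m = ℕ.≤-<-trans (ℕ.∣m-n∣≤m⊔n p q) (ℕ.⊔-lub p<m q<m)
    step-≤ : ∀ k → k ℕ.< n → ∣ h′ (suc (2 ℕ.* k)) - h′ (2 ℕ.* k) ∣ ≤ L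
    step-≤ k k<n with ∣-∣-suc (2 ℕ.* k) q
    ... | inj₁ eq = subst (λ e → ∣ h e - h ℕ.∣ 2 ℕ.* k - q ∣ ∣ ≤ L) (sym eq) (h-Lip ℕ.∣ 2 ℕ.* k - q ∣ (dist<m (even< k<n)))
    ... | inj₂ eq = subst (λ e → ∣ h ℕ.∣ suc (2 ℕ.* k) - q ∣ - h e ∣ ≤ L) (sym eq)
      (≤-trans (≤-reflexive (trans (cong ∣_∣ (lem (h ℕ.∣ suc (2 ℕ.* k) - q ∣) (h (suc ℕ.∣ suc (2 ℕ.* k) - q ∣)))) (ℚ.∣-p∣≡∣p∣ _)))
        (h-Lip ℕ.∣ suc (2 ℕ.* k) - q ∣ (dist<m (odd< k<n))))
      where
      lem : ∀ a b → a - b ≡ - (b - a)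
      lem = solve-∀ ℚ-ring

-- From a bound on the difference to a bound on the quotient

∣÷∣-< : ∀ p q r {ε} → 0ℚ < q → ∣ p - r * q ∣ < ε * q → ∣ (p ÷' q) - r ∣ < ε
∣÷∣-< p q r {ε} 0<q bound with q ℚ.≟ 0ℚ
... | yes refl = ⊥-elim (ℚ.<-irrefl refl 0<q)
... | no  q≢0  = ℚ.*-cancelʳ-<-nonNeg q {{nonNegative (ℚ.<⇒≤ 0<q)}} (subst (_< ε * q) eq bound)
  where
  instance
    q≠0 : ℚ.NonZero q
    q≠0 = ℚ.≢-nonZero q≢0
  eq : ∣ p - r * q ∣ ≡ ∣ p * ℚ.1/ q - r ∣ * q
  eq = begin
    ∣ p - r * q ∣                       ≡⟨ cong (λ s → ∣ s - r * q ∣) (trans (sym (ℚ.*-identityʳ p)) (cong (p *_) (sym (ℚ.*-inverseˡ q)))) ⟩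
    ∣ p * (ℚ.1/ q * q) - r * q ∣        ≡⟨ cong ∣_∣ (lem p (ℚ.1/ q) q r) ⟩
    ∣ (p * ℚ.1/ q - r) * q ∣            ≡⟨ ℚ.∣p*q∣≡∣p∣*∣q∣ (p * ℚ.1/ q - r) q ⟩
    ∣ p * ℚ.1/ q - r ∣ * ∣ q ∣          ≡⟨ cong (∣ p * ℚ.1/ q - r ∣ *_) (ℚ.0≤p⇒∣p∣≡p (ℚ.<⇒≤ 0<q)) ⟩
    ∣ p * ℚ.1/ q - r ∣ * q              ∎
    where
    open ≡-Reasoning
    lem : ∀ p i q r → p * (i * q) - r * q ≡ (p * i - r) * q
    lem = solve-∀ ℚ-ring

-- The product is the numerator of `ε`, a positive integer. This makes the final threshold explicit
-- in `ε`.
1≤ε*den : ∀ ε → 0ℚ < ε → 1ℚ ≤ ε * fromℕ (ℚ.denominatorℕ ε)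
1≤ε*den ε@(ℚ.mkℚ (ℤ.+ suc k) d _) _ = ℚ.toℚᵘ-cancel-≤ (begin
  toℚᵘ 1ℚ                                              ≤⟨ ℚᵘ.*≤* (ℤ.+≤+ le) ⟩
  ℚᵘ.mkℚᵘ (ℤ.+ suc k) d ℚᵘ.* ℚᵘ.mkℚᵘ (ℤ.+ suc d) 0     ≃⟨ ℚᵘ.*-congˡ {ℚᵘ.mkℚᵘ (ℤ.+ suc k) d} (fromℕ≃ (suc d)) ⟨
  toℚᵘ ε ℚᵘ.* toℚᵘ (fromℕ (suc d))                     ≃⟨ ℚ.toℚᵘ-homo-* ε (fromℕ (suc d)) ⟨
  toℚᵘ (ε * fromℕ (suc d))                             ∎)
  where
  open ℚᵘ.≤-Reasoning
  le : 1 ℕ.* (suc d ℕ.* 1) ℕ.≤ suc k ℕ.* suc d ℕ.* 1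
  le = subst₂ ℕ._≤_ (sym (trans (ℕ.*-identityˡ (suc d ℕ.* 1)) (ℕ.*-identityʳ (suc d)))) (sym (ℕ.*-identityʳ (suc k ℕ.* suc d)))
    (ℕ.m≤m+n (suc d) (k ℕ.* suc d))
1≤ε*den (ℚ.mkℚ (ℤ.+ 0) _ _)   (ℚ.*<* (ℤ.+<+ ()))
1≤ε*den (ℚ.mkℚ ℤ.-[1+ _ ] _ _) (ℚ.*<* ())

-- Both indices as degree-weighted double sums

degreeForm : ∀ {N} → Adj N → (Fin N → Fin N → ℚ) → ℚ
degreeForm {N} g f = ∑ (allFin N) (λ i → fromℕ (deg g i) * ∑ (allFin N) (λ j → fromℕ (deg g j) * f i j))

module _ {N : ℕ} (g : Adj N) where

  ΣΣ≡∑∑ : ∀ (f : Fin N → Fin N → ℚ) → Σ (λ i → Σ (f i)) ≡ ∑ (allFin N) (λ i → ∑ (allFin N) (f i))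
  ΣΣ≡∑∑ f = trans (∑-foldr (allFin N) (λ i → Σ (f i))) (∑-cong (allFin N) (λ i → ∑-foldr (allFin N) (f i)))

  KfStar-degreeForm : ∀ R → KfStar g R ≡ ½ * degreeForm g R
  KfStar-degreeForm R = cong (½ *_) (trans (ΣΣ≡∑∑ (λ i j → fromℕ (deg g i ℕ.* deg g j) * R i j)) (∑-cong (allFin N) (λ i → trans
    (∑-cong (allFin N) (λ j → trans (cong (_* R i j) (fromℕ-* (deg g i) (deg g j))) (ℚ.*-assoc (fromℕ (deg g i)) (fromℕ (deg g j)) (R i j))))
    (∑-*ˡ (allFin N) (fromℕ (deg g i)) (λ j → fromℕ (deg g j) * R i j)))))

  -- `Gut` is `KfStar` with the distance in place of the resistance, once the cast of the triple
  -- product is split.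
  Gut-degreeForm : Gut g ≡ ½ * degreeForm g (λ i j → fromℕ (dist g i j))
  Gut-degreeForm = trans (cong (½ *_) (trans (ΣΣ≡∑∑ (λ i j → fromℕ (deg g i ℕ.* deg g j ℕ.* dist g i j)))
    (trans (∑-cong (allFin N) (λ i → ∑-cong (allFin N) (λ j → fromℕ-* (deg g i ℕ.* deg g j) (dist g i j))))
      (sym (ΣΣ≡∑∑ (λ i j → fromℕ (deg g i ℕ.* deg g j) * fromℕ (dist g i j)))))))
    (KfStar-degreeForm (λ i j → fromℕ (dist g i j)))

-- Comparison of the Gutman index with three times the Kirchhoff index

module ChainRatio (tw : Bool) (n l : ℕ) (2n≡m : 2 ℕ.* n ≡ suc l) (2≤l : 2 ℕ.≤ l) where

  open Chain tw n l 2n≡m 2≤l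
  open ChainResistance tw n l 2n≡m 2≤l
  open ChainDistance tw n l 2n≡m 2≤l using (cyc≤dist; dist≤cyc+4)
  open ChainRows tw n l 2n≡m 2≤l

  d : Fin N → ℚ
  d i = degree N edges (toℕ i)

  0≤d : ∀ i → 0ℚ ≤ d i
  0≤d i = ≤-trans (≤-reflexive (sym (∑-zero (upTo N)))) (∑-mono (upTo N) (λ v → ⟦⟧-nonneg (adj edges (toℕ i) v)))

  -- The total degree, that is, twice the number 7 n of edges; `A-const` verifies it.
  W : ℚ
  W = fromℕ 14 * ν

  A : (Fin N → ℚ) → ℚ
  A f = ∑ (allFin N) (λ i → d i * f i)

  A-const : ∀ b → A (λ _ → b) ≡ W * b
  A-const b = begin
    A (λ _ → b)                                  ≡⟨ ∑-*ʳ (allFin N) b d ⟩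
    ∑ (allFin N) d * b                           ≡⟨ cong (_* b) (∑-allFin N (degree N edges)) ⟩
    ∑< N (degree N edges) * b                    ≡⟨ cong (_* b) (∑-cong (upTo N) (λ v → sym (ℚ.*-identityʳ (degree N edges v)))) ⟩
    ∑< N (λ v → degree N edges v * 1ℚ) * b       ≡⟨ cong (_* b) (∑-degree-pos (λ _ → 1ℚ)) ⟩
    (fromℕ 6 * ∑< n (λ _ → 1ℚ) + fromℕ 8 * ∑< n (λ _ → 1ℚ)) * b
      ≡⟨ cong (λ s → (fromℕ 6 * s + fromℕ 8 * s) * b) (∑<-const n 1ℚ) ⟩
    (fromℕ 6 * (ν * 1ℚ) + fromℕ 8 * (ν * 1ℚ)) * b
      ≡⟨ lem ν b ⟩
    W * b ∎
    where
    open ≡-Reasoning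
    lem : ∀ ν b → (fromℕ 6 * (ν * 1ℚ) + fromℕ 8 * (ν * 1ℚ)) * b ≡ fromℕ 14 * ν * b
    lem = solve-∀ ℚ-ring

  A-cong : ∀ {f g} → (∀ i → f i ≡ g i) → A f ≡ A g
  A-cong eq = ∑-cong (allFin N) (λ i → cong (d i *_) (eq i))

  A-linear : ∀ a b f g → A (λ i → a * f i + b * g i) ≡ a * A f + b * A g
  A-linear a b f g = begin
    A (λ i → a * f i + b * g i)
      ≡⟨ ∑-cong (allFin N) (λ i → lem (d i) a (f i) b (g i)) ⟩
    ∑ (allFin N) (λ i → a * (d i * f i) + b * (d i * g i))
      ≡⟨ ∑-+ (allFin N) (λ i → a * (d i * f i)) (λ i → b * (d i * g i)) ⟩
    ∑ (allFin N) (λ i → a * (d i * f i)) + ∑ (allFin N) (λ i → b * (d i * g i))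
      ≡⟨ cong₂ _+_ (∑-*ˡ (allFin N) a (λ i → d i * f i)) (∑-*ˡ (allFin N) b (λ i → d i * g i)) ⟩
    a * A f + b * A g ∎
    where
    open ≡-Reasoning
    lem : ∀ d a f b g → d * (a * f + b * g) ≡ a * (d * f) + b * (d * g)
    lem = solve-∀ ℚ-ring

  A-mono : ∀ {f g} → (∀ i → f i ≤ g i) → A f ≤ A g
  A-mono f≤g = ∑-mono (allFin N) (λ i → *-mono-nonneg (0≤d i) (f≤g i))

  A-∣∣ : ∀ {f} b → (∀ i → ∣ f i ∣ ≤ b) → ∣ A f ∣ ≤ W * b
  A-∣∣ {f} b f≤b = ≤-trans (∑-∣∣ (allFin N) (λ i → ∣∣-* (0≤d i) (f≤b i))) (≤-reflexive (A-const b))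

  S : (Fin N → Fin N → ℚ) → ℚ
  S f = A (λ i → A (f i))

  S-linear : ∀ a b f g → S (λ i j → a * f i j + b * g i j) ≡ a * S f + b * S g
  S-linear a b f g = trans (A-cong (λ i → A-linear a b (f i) (g i))) (A-linear a b (λ i → A (f i)) (λ i → A (g i)))

  S-∣∣ : ∀ {f} b → (∀ i j → ∣ f i j ∣ ≤ b) → ∣ S f ∣ ≤ W * (W * b)
  S-∣∣ b f≤b = A-∣∣ (W * b) (λ i → A-∣∣ b (f≤b i))

  gap : Fin N → Fin N → ℕ
  gap i j = ℕ.∣ pos (toℕ i) - pos (toℕ j) ∣

  A-row : ∀ h i → A (λ j → h (gap i j)) ≡ row h (pos (toℕ i))
  A-row h i = trans (A-cong (λ j → cong h (ℕ.∣-∣-comm (pos (toℕ i)) (pos (toℕ j)))))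
    (∑-allFin N (λ v → degree N edges v * h ℕ.∣ pos v - pos (toℕ i) ∣))

  S-H : ∣ S (λ i j → H (gap i j)) ∣ ≤ W * (fromℕ 7 * ν + ν * (fromℕ 5 * μ))
  S-H = A-∣∣ _ (λ i → ≤-trans (≤-reflexive (cong ∣_∣ (trans (A-row H i) (lem (row H (pos (toℕ i))) (fromℕ 7 * ∑< m H)))))
    (∣∣-+ (fromℕ 7 * ∑< m H) (row H (pos (toℕ i)) - fromℕ 7 * ∑< m H)
      (≤-reflexive (trans (cong (λ s → ∣ fromℕ 7 * s ∣) ∑H) (ℚ.0≤p⇒∣p∣≡p (*-nonneg (fromℕ-nonneg 7) 0≤ν))))
      (row-≈ H (fromℕ 5 * μ) H-sym H-Lipschitz (pos<m (Fin.toℕ<n i)))))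
    where
    lem : ∀ r s → r ≡ s + (r - s)
    lem = solve-∀ ℚ-ring

  -- Supplies the cubic growth: each row is 7 ν² up to ν, and the total degree 14 ν yields the
  -- leading term 98 ν³.
  S-c : W * (fromℕ 7 * (ν * ν) - ν * 1ℚ) ≤ S (λ i j → c (gap i j))
  S-c = ≤-trans (≤-reflexive (sym (A-const _))) (A-mono (λ i → ≤-trans
    (≤-shift (≤-trans (-x≤∣x∣ _) (row-≈ c 1ℚ c-sym c-Lipschitz (pos<m (Fin.toℕ<n i)))) (lem (row c (pos (toℕ i))) (∑< m c) ∑c))
    (≤-reflexive (sym (A-row c i)))))
    where
    lem : ∀ r s → s ≡ ν * ν → r - (fromℕ 7 * (ν * ν) - ν * 1ℚ) ≡ ν * 1ℚ - (- (r - fromℕ 7 * s))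
    lem r s refl = lem′ r (ν * ν) (ν * 1ℚ)
      where
      lem′ : ∀ r s t → r - (fromℕ 7 * s - t) ≡ t - (- (r - fromℕ 7 * s))
      lem′ = solve-∀ ℚ-ring

  D : Fin N → Fin N → ℚ
  D i j = fromℕ (dist (fromEdges edges) i j)

  D-≈ : ∀ i j → ∣ D i j - c (gap i j) ∣ ≤ fromℕ 4
  D-≈ i j = fromℕ-∣diff∣-≤ (dist (fromEdges edges) i j) (cyc m (pos (toℕ i)) (pos (toℕ j))) 4 (dist≤cyc+4 i j)
    (ℕ.≤-trans (cyc≤dist i j) (ℕ.m≤n+m _ 4))

  fromℕ-deg-degreeForm : ∀ f → degreeForm (fromEdges {N} edges) f ≡ S f
  fromℕ-deg-degreeForm f = ∑-cong (allFin N) (λ i → cong₂ _*_ (fromℕ-deg edges i)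
    (∑-cong (allFin N) (λ j → cong (_* f i j) (fromℕ-deg edges j))))

  Gut≡ : Gut (fromEdges {N} edges) ≡ ½ * S D
  Gut≡ = trans (Gut-degreeForm (fromEdges {N} edges)) (cong (½ *_) (fromℕ-deg-degreeForm D))

  module _ (R : Fin N → Fin N → ℚ) (R-resistance : IsResistance (fromEdges edges) R) where

    KfStar≡ : KfStar (fromEdges {N} edges) R ≡ ½ * S R
    KfStar≡ = trans (KfStar-degreeForm (fromEdges {N} edges) R) (cong (½ *_) (fromℕ-deg-degreeForm R))

    R-≈ : ∀ i j → ∣ fromℕ 2 * μ * R i j - ρ (gap i j) ∣ ≤ fromℕ 4 * μ
    R-≈ i j = subst (λ r → ∣ fromℕ 2 * μ * r - ρ (gap i j) ∣ ≤ fromℕ 4 * μ)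
      (sym (trans (proj₂ (proj₂ (R-resistance i j))) (sym (cong₂ _-_ (extend-toℕ x i) (extend-toℕ x j)))))
      (resistance-≈ (extend x) (Fin.toℕ<n i) (Fin.toℕ<n j) (potential edges edges✓ edges# i j x (proj₁ (proj₂ (R-resistance i j)))))
      where
      x : Fin N → ℚ
      x = proj₁ (R-resistance i j)

    -- The constant 20 is 2 · 4 from the distances plus 3 · 4 from the resistances.
    T-≈ : ∀ i j → ∣ (fromℕ 2 * μ * D i j + (- (fromℕ 6 * μ)) * R i j) - H (gap i j) ∣ ≤ fromℕ 20 * μ
    T-≈ i j = ≤-trans (≤-reflexive (cong ∣_∣ (lem μ (D i j) (R i j) (c (gap i j)) (ρ (gap i j)))))
      (≤-trans (∣∣-+ (fromℕ 2 * μ * (D i j - c (gap i j))) (- (fromℕ 3 * (fromℕ 2 * μ * R i j - ρ (gap i j))))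
        (∣∣-* (*-nonneg (fromℕ-nonneg 2) 0≤μ) (D-≈ i j))
        (≤-trans (≤-reflexive (ℚ.∣-p∣≡∣p∣ (fromℕ 3 * (fromℕ 2 * μ * R i j - ρ (gap i j))))) (∣∣-* (fromℕ-nonneg 3) (R-≈ i j))))
        (≤-reflexive (lem′ μ)))
      where
      lem : ∀ μ D R c ρ → (fromℕ 2 * μ * D + (- (fromℕ 6 * μ)) * R) - (fromℕ 2 * μ * c - fromℕ 3 * ρ)
        ≡ fromℕ 2 * μ * (D - c) + (- (fromℕ 3 * (fromℕ 2 * μ * R - ρ)))
      lem = solve-∀ ℚ-ring
      lem′ : ∀ μ → fromℕ 2 * μ * fromℕ 4 + fromℕ 3 * (fromℕ 4 * μ) ≡ fromℕ 20 * μ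
      lem′ = solve-∀ ℚ-ring

    Δ : ℚ
    Δ = S D - fromℕ 3 * S R

    -- A single value of `H` may be of order m², so `H` has to be summed along rows, where it
    -- cancels, before absolute values are taken. The remainder `E` is of order m for each pair and
    -- is bounded term by term.
    μΔ-bound : fromℕ 2 * μ * ∣ Δ ∣ ≤ W * (fromℕ 7 * ν + ν * (fromℕ 5 * μ)) + W * (W * (fromℕ 20 * μ))
    μΔ-bound = ≤-trans (≤-reflexive (trans (cong (_* ∣ Δ ∣) (sym (ℚ.0≤p⇒∣p∣≡p (*-nonneg (fromℕ-nonneg 2) 0≤μ))))
        (trans (sym (ℚ.∣p*q∣≡∣p∣*∣q∣ (fromℕ 2 * μ) Δ)) (cong ∣_∣ split))))
      (∣∣-+ (S (λ i j → H (gap i j))) (S E) S-H (S-∣∣ (fromℕ 20 * μ) T-≈))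
      where
      F E : Fin N → Fin N → ℚ
      F i j = fromℕ 2 * μ * D i j + (- (fromℕ 6 * μ)) * R i j
      E i j = F i j - H (gap i j)
      split : fromℕ 2 * μ * Δ ≡ S (λ i j → H (gap i j)) + S E
      split = begin
        fromℕ 2 * μ * Δ
          ≡⟨ lem μ (S D) (S R) ⟩
        fromℕ 2 * μ * S D + (- (fromℕ 6 * μ)) * S R
          ≡⟨ S-linear (fromℕ 2 * μ) (- (fromℕ 6 * μ)) D R ⟨
        S F
          ≡⟨ A-cong (λ i → A-cong (λ j → lem′ (F i j) (H (gap i j)))) ⟩
        S (λ i j → 1ℚ * H (gap i j) + 1ℚ * E i j)
          ≡⟨ S-linear 1ℚ 1ℚ (λ i j → H (gap i j)) E ⟩
        1ℚ * S (λ i j → H (gap i j)) + 1ℚ * S E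
          ≡⟨ cong₂ _+_ (ℚ.*-identityˡ (S (λ i j → H (gap i j)))) (ℚ.*-identityˡ (S E)) ⟩
        S (λ i j → H (gap i j)) + S E ∎
        where
        open ≡-Reasoning
        lem : ∀ μ D R → fromℕ 2 * μ * (D - fromℕ 3 * R) ≡ fromℕ 2 * μ * D + (- (fromℕ 6 * μ)) * R
        lem = solve-∀ ℚ-ring
        lem′ : ∀ t h → t ≡ 1ℚ * h + 1ℚ * (t - h)
        lem′ = solve-∀ ℚ-ring

    module _ (28≤n : 28 ℕ.≤ n) where

      28≤ν : fromℕ 28 ≤ ν
      28≤ν = fromℕ-mono {28} {n} 28≤n

      1≤ν : 1ℚ ≤ ν
      1≤ν = fromℕ-mono {1} {n} (ℕ.≤-trans (s≤s z≤n) 28≤n)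

      0<ν : 0ℚ < ν
      0<ν = ℚ.<-≤-trans (ℚ.positive⁻¹ 1ℚ) 1≤ν

      0≤ν² : 0ℚ ≤ ν * ν
      0≤ν² = *-nonneg 0≤ν 0≤ν

      -- With μ = 2 ν the right side of `μΔ-bound` is 7980 ν³ + 98 ν², against 4 ν times the claim,
      -- which is 8080 ν³. The quadratic term is absorbed because 1 ≤ ν.
      Δ-bound : ∣ Δ ∣ ≤ fromℕ 2020 * (ν * ν)
      Δ-bound = ℚ.*-cancelˡ-≤-pos ν {{ℚ.positive 0<ν}} (ℚ.*-cancelˡ-≤-pos (fromℕ 4) (≤-trans
        (≤-reflexive (lem₁ ν ∣ Δ ∣))
        (≤-trans (subst (λ μ → fromℕ 2 * μ * ∣ Δ ∣ ≤ W * (fromℕ 7 * ν + ν * (fromℕ 5 * μ)) + W * (W * (fromℕ 20 * μ))) μ≡2ν μΔ-bound)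
          (≤-shift (+-nonneg (*-nonneg (fromℕ-nonneg 98) (*-nonneg 0≤ν² (≤⇒0≤ 1≤ν))) (*-nonneg (fromℕ-nonneg 2) (*-nonneg 0≤ν² 0≤ν)))
            (lem₂ ν)))))
        where
        lem₁ : ∀ ν d → fromℕ 4 * (ν * d) ≡ fromℕ 2 * (fromℕ 2 * ν) * d
        lem₁ = solve-∀ ℚ-ring
        lem₂ : ∀ ν → fromℕ 4 * (ν * (fromℕ 2020 * (ν * ν)))
          - (fromℕ 14 * ν * (fromℕ 7 * ν + ν * (fromℕ 5 * (fromℕ 2 * ν))) + fromℕ 14 * ν * (fromℕ 14 * ν * (fromℕ 20 * (fromℕ 2 * ν))))
          ≡ (fromℕ 98 * (ν * ν * (ν - 1ℚ)) + fromℕ 2 * (ν * ν * ν)) - 0ℚ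
        lem₂ = solve-∀ ℚ-ring

      -- Since 3 S R = S D - Δ, it is at least 98 ν³ - 14 ν² - 2020 ν². Taking off 24 ν³ leaves 74
      -- ν³ - 2034 ν² = 74 ν² (ν - 28) + 38 ν², which is where the threshold 28 comes from.
      S-R-bound : fromℕ 8 * (ν * ν * ν) ≤ S R
      S-R-bound = ℚ.*-cancelˡ-≤-pos (fromℕ 3) (≤-shift
        (+-nonneg (+-nonneg (≤⇒0≤ (≤-trans S-c (A-mono (λ i → A-mono (λ j → fromℕ-mono (cyc≤dist i j))))))
                            (≤⇒0≤ (≤-trans (x≤∣x∣ Δ) Δ-bound)))
          (+-nonneg (*-nonneg (fromℕ-nonneg 74) (*-nonneg 0≤ν² (≤⇒0≤ 28≤ν))) (*-nonneg (fromℕ-nonneg 38) 0≤ν²)))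
        (lem ν (S D) (S R)))
        where
        lem : ∀ ν D R → fromℕ 3 * R - fromℕ 3 * (fromℕ 8 * (ν * ν * ν)) ≡
          (((D - fromℕ 14 * ν * (fromℕ 7 * (ν * ν) - ν * 1ℚ)) + (fromℕ 2020 * (ν * ν) - (D - fromℕ 3 * R)))
            + (fromℕ 74 * (ν * ν * (ν - fromℕ 28)) + fromℕ 38 * (ν * ν))) - 0ℚ
        lem = solve-∀ ℚ-ring

      0<ν³ : 0ℚ < ν * ν * ν
      0<ν³ = ℚ.positive⁻¹ (ν * ν * ν) {{ℚ.pos*pos⇒pos (ν * ν) {{ℚ.pos*pos⇒pos ν ν}} ν}}
        where
        instance
          ν-pos : ℚ.Positive ν
          ν-pos = ℚ.positive 0<ν

      Kf-bound : fromℕ 4 * (ν * ν * ν) ≤ KfStar (fromEdges {N} edges) R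
      Kf-bound = ≤-trans (≤-reflexive (lem (ν * ν * ν))) (≤-trans (ℚ.*-monoˡ-≤-nonNeg ½ S-R-bound) (≤-reflexive (sym KfStar≡)))
        where
        lem : ∀ p → fromℕ 4 * p ≡ ½ * (fromℕ 8 * p)
        lem = solve-∀ ℚ-ring

      ratio : ∀ ε → 0ℚ < ε → fromℕ 253 ≤ ε * ν →
        ∣ (Gut (fromEdges {N} edges) ÷' KfStar (fromEdges {N} edges) R) - fromℕ 3 ∣ < ε
      ratio ε 0<ε 253≤εν = ∣÷∣-< (Gut (fromEdges {N} edges)) Kf (fromℕ 3) 0<Kf (ℚ.≤-<-trans num (ℚ.<-≤-trans small (*-mono-nonneg (ℚ.<⇒≤ 0<ε) Kf-bound)))
        where
        Kf : ℚ
        Kf = KfStar (fromEdges {N} edges) R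
        0<Kf : 0ℚ < Kf
        0<Kf = ℚ.<-≤-trans (subst (_< fromℕ 4 * (ν * ν * ν)) (ℚ.*-zeroʳ (fromℕ 4)) (ℚ.*-monoʳ-<-pos (fromℕ 4) 0<ν³)) Kf-bound
        num : ∣ Gut (fromEdges {N} edges) - fromℕ 3 * Kf ∣ ≤ ½ * (fromℕ 2020 * (ν * ν))
        num = ≤-trans (≤-reflexive (trans (cong ∣_∣ (trans (cong₂ (λ g k → g - fromℕ 3 * k) Gut≡ KfStar≡) (lem (S D) (S R))))
          (ℚ.∣p*q∣≡∣p∣*∣q∣ ½ Δ))) (ℚ.*-monoˡ-≤-nonNeg ½ Δ-bound)
          where
          lem : ∀ D R → ½ * D - fromℕ 3 * (½ * R) ≡ ½ * (D - fromℕ 3 * R)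
          lem = solve-∀ ℚ-ring
        -- From ε ν ≥ 253 the right side is at least 1012 ν², against 1010 ν² on the left. One of
        -- the two spare ν² makes the inequality strict.
        small : ½ * (fromℕ 2020 * (ν * ν)) < ε * (fromℕ 4 * (ν * ν * ν))
        small = ℚ.<-≤-trans
          (subst (_< ½ * (fromℕ 2020 * (ν * ν)) + ν * ν) (ℚ.+-identityʳ _)
            (ℚ.+-monoʳ-< (½ * (fromℕ 2020 * (ν * ν))) (ℚ.positive⁻¹ (ν * ν) {{ℚ.pos*pos⇒pos ν {{ℚ.positive 0<ν}} ν {{ℚ.positive 0<ν}}}})))
          (≤-shift (+-nonneg (*-nonneg (*-nonneg (fromℕ-nonneg 4) 0≤ν²) (≤⇒0≤ 253≤εν)) 0≤ν²) (lem ε ν))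
          where
          lem : ∀ ε ν → ε * (fromℕ 4 * (ν * ν * ν)) - (½ * (fromℕ 2020 * (ν * ν)) + ν * ν)
            ≡ (fromℕ 4 * (ν * ν) * (ε * ν - fromℕ 253) + ν * ν) - 0ℚ
          lem = solve-∀ ℚ-ring

-- Transfer to the cylinder and Möbius chains as labelled in the statement

double : ∀ n → 2 ℕ.≤ n → ∃ λ l → 2 ℕ.* n ≡ suc l × 2 ℕ.≤ l
double (suc n) (s≤s 1≤n) = suc (2 ℕ.* n) , ℕ.*-suc 2 n , s≤s (ℕ.≤-trans 1≤n (ℕ.m≤m+n n (n ℕ.+ 0)))

chainEdges : Bool → ℕ → List (ℕ × ℕ)
chainEdges true  = moebiusEdges
chainEdges false = cylinderEdges

module _ {n l : ℕ} (2n≡m : 2 ℕ.* n ≡ suc l) (2≤l : 2 ℕ.≤ l) where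

  4n≡m+m : 4 ℕ.* n ≡ suc l ℕ.+ suc l
  4n≡m+m = trans (ℕ.*-distribʳ-+ n 2 2) (cong₂ ℕ._+_ 2n≡m 2n≡m)

  5n≡N : 5 ℕ.* n ≡ suc l ℕ.+ suc l ℕ.+ n
  5n≡N = trans (ℕ.+-comm n (4 ℕ.* n)) (cong (ℕ._+ n) 4n≡m+m)

  -- Both lists are instances of `rails`, which takes 2 n and 4 n as separate parameters so that
  -- each can be rewritten; at `suc l` the truncated predecessor computes to `l`.
  commonEdges≡ : ∀ tw → commonEdges n ≡ Chain.commons tw n l 2n≡m 2≤l
  commonEdges≡ tw = cong₂ rails 2n≡m 4n≡m+m
    where
    rails : ℕ → ℕ → List (ℕ × ℕ)
    rails m 2m = map (λ i → i , suc i) (upTo (m ℕ.∸ 1)) ++ map (λ i → m ℕ.+ i , m ℕ.+ suc i) (upTo (m ℕ.∸ 1))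
      ++ map (λ i → 2 ℕ.* i , m ℕ.+ 2 ℕ.* i) (upTo n) ++ map (λ i → suc (2 ℕ.* i) , 2m ℕ.+ i) (upTo n)
      ++ map (λ i → 2m ℕ.+ i , m ℕ.+ suc (2 ℕ.* i)) (upTo n)

  chainEdges≡ : ∀ tw → chainEdges tw n ≡ Chain.edges tw n l 2n≡m 2≤l
  chainEdges≡ true  = cong₂ _∷_ (cong₂ _,_ (cong (ℕ._∸ 1) 2n≡m) 2n≡m)
    (cong₂ _∷_ (cong (_, 0) (trans (cong (ℕ._∸ 1) 4n≡m+m) (ℕ.+-suc l l))) (commonEdges≡ true))
  chainEdges≡ false = cong₂ _∷_ (cong (_, 0) (cong (ℕ._∸ 1) 2n≡m))
    (cong₂ _∷_ (cong₂ _,_ (trans (cong (ℕ._∸ 1) 4n≡m+m) (ℕ.+-suc l l)) 2n≡m) (commonEdges≡ false))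

chain-ratio : ∀ tw → RatioTendsTo3 (λ n → fromEdges (chainEdges tw n))
-- 28 secures the lower bound on Kf*; as ε times its denominator `k` is at least 1, n ≥ 253 k
-- secures ε n ≥ 253.
chain-ratio tw ε 0<ε = 28 ℕ.+ 253 ℕ.* k , λ n 2≤n n₀≤n → main n n₀≤n (double n 2≤n)
  where
  k : ℕ
  k = ℚ.denominatorℕ ε
  main : ∀ n → 28 ℕ.+ 253 ℕ.* k ℕ.≤ n → (∃ λ l → 2 ℕ.* n ≡ suc l × 2 ℕ.≤ l) →
    ∀ R → IsResistance (fromEdges {5 ℕ.* n} (chainEdges tw n)) R →
    ∣ (Gut (fromEdges {5 ℕ.* n} (chainEdges tw n)) ÷' KfStar (fromEdges {5 ℕ.* n} (chainEdges tw n)) R) - fromℕ 3 ∣ < ε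
  -- The claim is transported with `R` still quantified, because the type of `R` depends on the
  -- number of vertices being rewritten.
  main n n₀≤n (l , 2n≡m , 2≤l) = subst₂ (λ N es → ∀ R → IsResistance (fromEdges {N} es) R →
      ∣ (Gut (fromEdges {N} es) ÷' KfStar (fromEdges {N} es) R) - fromℕ 3 ∣ < ε)
    (sym (5n≡N 2n≡m 2≤l)) (sym (chainEdges≡ 2n≡m 2≤l tw))
    (λ R isR → ChainRatio.ratio tw n l 2n≡m 2≤l R isR (ℕ.≤-trans (ℕ.m≤m+n 28 (253 ℕ.* k)) n₀≤n) ε 0<ε 253≤εν)
    where
    253≤εν : fromℕ 253 ≤ ε * fromℕ n
    253≤εν = ≤-trans (≤-trans (*-mono-nonneg (fromℕ-nonneg 253) (1≤ε*den ε 0<ε)) (≤-reflexive (trans (lem ε (fromℕ k)) (cong (ε *_) (sym (fromℕ-* 253 k))))))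
      (*-mono-nonneg (ℚ.<⇒≤ 0<ε) (fromℕ-mono {253 ℕ.* k} {n} (ℕ.≤-trans (ℕ.m≤n+m (253 ℕ.* k) 28) n₀≤n)))
      where
      lem : ∀ ε k → fromℕ 253 * (ε * k) ≡ ε * (fromℕ 253 * k)
      lem = solve-∀ ℚ-ring

theorem12 : RatioTendsTo3 Pcyl × RatioTendsTo3 Pmob
theorem12 = chain-ratio false , chain-ratio true
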